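{- For every cubic graph $G$, $\nu_2(G) \geq \frac{16}{17}\cdot \frac{|V(G)| + 2\cdot \nu_3(G)}{4}$.
   Context: Graphs are finite, without loops, possibly with multiple edges; a graph is cubic if every vertex has degree $3$. For $k\geq 1$, $\nu_k(G)$ is the maximum number of edges of a $k$-edge-colorable subgraph of $G$. -}

module Defs where

open import Data.Fin.Base using (Fin; zero; finToFun; funToFin)
open import Data.Fin.Properties using (_≟_; any?; all?; finToFun-funToFin)
open import Data.Fin.Subset using (Subset; _∈_; ∣_∣; ⊤; ⊥)
open import Data.Fin.Subset.Properties using (_∈?_; anySubset?; ∈⊤; ∉⊥; ∣p∣≤n; ∣⊥∣≡0)
open import Data.Nat.Base using (ℕ; zero; suc; _≤_; NonZero)
import Data.Nat.Properties as ℕ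
open import Data.Product.Base using (Σ; ∃; _×_; _,_; proj₁; proj₂)
open import Data.Sum.Base using (_⊎_)
open import Data.Vec.Base using (allFin; count)
open import Relation.Binary.PropositionalEquality using (_≡_; _≢_; refl; sym; subst; trans)
open import Relation.Nullary using (Dec; yes; no)
open import Relation.Nullary.Decidable using (map′; _×-dec_; _⊎-dec_; _→-dec_; ¬?)
open import Relation.Unary using (Pred; Decidable)

-- Edges are labelled, so distinct edges may have the same ends.  The order in
-- which `ends` lists the two ends plays no role in what follows.
record Graph : Set where
  field
    ∣V∣      : ℕ
    ∣E∣      : ℕ
    ends     : Fin ∣E∣ → Fin ∣V∣ × Fin ∣V∣
    loopless : ∀ e → proj₁ (ends e) ≢ proj₂ (ends e)

  Vertex : Set
  Vertex = Fin ∣V∣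

  Edge : Set
  Edge = Fin ∣E∣

  Incident : Vertex → Edge → Set
  Incident v e = v ≡ proj₁ (ends e) ⊎ v ≡ proj₂ (ends e)

  incident? : ∀ v e → Dec (Incident v e)
  incident? v e = v ≟ proj₁ (ends e) ⊎-dec v ≟ proj₂ (ends e)

  degree : Vertex → ℕ
  degree v = count (incident? v) (allFin ∣E∣)

open Graph public

Cubic : Graph → Set
Cubic G = ∀ v → degree G v ≡ 3

record Subgraph (G : Graph) : Set where
  field
    vertices : Subset (∣V∣ G)
    edges    : Subset (∣E∣ G)
    closed   : ∀ e v → e ∈ edges → Incident G v e → v ∈ vertices

open Subgraph public

-- The colouring is a function on all edges of G, of which only the values on F
-- matter; for k ≥ 1 every colouring of F alone extends to such a function.
ProperOn : (G : Graph) {k : ℕ} → Subset (∣E∣ G) → (Edge G → Fin k) → Set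
ProperOn G F c = ∀ e f → e ∈ F → f ∈ F → e ≢ f →
                 ∀ v → Incident G v e → Incident G v f → c e ≢ c f

EdgeColourable : {G : Graph} (k : ℕ) .{{_ : NonZero k}} → Subgraph G → Set
EdgeColourable {G} k H = ∃ λ (c : Edge G → Fin k) → ProperOn G (edges H) c

ColourableSize : (G : Graph) (k : ℕ) .{{_ : NonZero k}} → ℕ → Set
ColourableSize G k x =
  Σ (Subgraph G) λ H → EdgeColourable k H × ∣ edges H ∣ ≡ x

IsMaximum : ∀ {ℓ} → Pred ℕ ℓ → Pred ℕ ℓ
IsMaximum P x = P x × (∀ y → P y → y ≤ x)

∃-maximum : ∀ {ℓ} {P : Pred ℕ ℓ} → Decidable P → P 0 →
            ∀ b → (∀ y → P y → y ≤ b) → ∃ (IsMaximum P)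
∃-maximum P? p₀ zero    bnd = 0 , p₀ , bnd
∃-maximum {P = P} P? p₀ (suc b) bnd with P? (suc b)
... | yes p = suc b , p , bnd
... | no ¬p = ∃-maximum P? p₀ b λ y py →
  ℕ.m<1+n⇒m≤n (ℕ.≤∧≢⇒< (bnd y py) λ y≡1+b → ¬p (subst P y≡1+b py))

properOn? : (G : Graph) {k : ℕ} (F : Subset (∣E∣ G)) (c : Edge G → Fin k) →
            Dec (ProperOn G F c)
properOn? G F c = all? λ e → all? λ f →
  e ∈? F →-dec f ∈? F →-dec ¬? (e ≟ f) →-dec
  all? λ v → incident? G v e →-dec incident? G v f →-dec ¬? (c e ≟ c f)

properOn-≗ : (G : Graph) {k : ℕ} (F : Subset (∣E∣ G)) {c d : Edge G → Fin k} →
             (∀ e → c e ≡ d e) → ProperOn G F c → ProperOn G F d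
properOn-≗ G F c≗d p e f e∈F f∈F e≢f v ve vf de≡df =
  p e f e∈F f∈F e≢f v ve vf (trans (c≗d e) (trans de≡df (sym (c≗d f))))

∃-properOn? : (G : Graph) (k : ℕ) (F : Subset (∣E∣ G)) →
              Dec (∃ λ (c : Edge G → Fin k) → ProperOn G F c)
∃-properOn? G k F = map′
  (λ (i , p) → finToFun i , p)
  (λ (c , p) → funToFin c , properOn-≗ G F (λ e → sym (finToFun-funToFin c e)) p)
  (any? λ i → properOn? G F (finToFun {k} {∣E∣ G} i))

spanning : (G : Graph) → Subset (∣E∣ G) → Subgraph G
spanning G F = record { vertices = ⊤ ; edges = F ; closed = λ _ _ _ _ → ∈⊤ }

colourableSize? : (G : Graph) (k : ℕ) .{{_ : NonZero k}} → Decidable (ColourableSize G k)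
colourableSize? G k x = map′
  (λ (F , p) → spanning G F , p)
  (λ (H , p) → edges H , p)
  (anySubset? λ F → ∃-properOn? G k F ×-dec ∣ F ∣ ℕ.≟ x)

colourableSize-0 : (G : Graph) (k : ℕ) .{{_ : NonZero k}} → ColourableSize G k 0
colourableSize-0 G (suc k) =
  spanning G ⊥ ,
  ((λ _ → zero) , λ _ _ e∈⊥ _ _ _ _ _ _ → ∉⊥ e∈⊥) ,
  ∣⊥∣≡0 (∣E∣ G)

∃-ν : (G : Graph) (k : ℕ) .{{_ : NonZero k}} → ∃ (IsMaximum (ColourableSize G k))
∃-ν G k = ∃-maximum (colourableSize? G k) (colourableSize-0 G k) (∣E∣ G)
  λ { _ (H , _ , refl) → ∣p∣≤n (edges H) }

ν : (k : ℕ) .{{_ : NonZero k}} → Graph → ℕ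
ν k G = proj₁ (∃-ν G k)

ν-isMaximum : (k : ℕ) .{{_ : NonZero k}} (G : Graph) → IsMaximum (ColourableSize G k) (ν k G)
ν-isMaximum k G = proj₂ (∃-ν G k)

{-# OPTIONS --safe #-}

-- The claim follows from 3 ν₂ ≥ 2 ν₃ (drop the smallest of three colour
-- classes) and 5 ν₂ ≥ 4 |V|.  For the latter take a partial edge colouring with
-- two colours that has, lexicographically, the most coloured edges and then the
-- largest value of 3 · #(coloured edges with a parallel edge) + #(vertices with a
-- coloured edge).  A vertex that misses a colour is an end of a two-coloured path;
-- its uncoloured neighbours see both colours, except that the two ends of one
-- path may be adjacent.  A vertex seeing both colours has exactly one uncoloured
-- edge, so it can be charged to the end of that edge.  Give every vertex two units
-- and let them flow to the deficient vertices: each end of a path then collects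
-- five units and each isolated vertex ten.  As the number of coloured edges is |V|
-- minus half the total deficiency, the bound follows.  The cases in which charging
-- the uncoloured neighbours does not suffice are isolated vertices and pairs of
-- adjacent path ends; these draw on coloured edges (`relay` below).
module Submission where

open import Defs
import Algebra.Properties.CommutativeMonoid.Sum
import Algebra.Properties.Semiring.Sum
open import Data.Bool.Base using (Bool; true; false; not; if_then_else_)
open import Data.Bool.Properties as Bool using (¬-not; not-¬; not-involutive)
open import Data.Empty using (⊥; ⊥-elim)
open import Data.Fin.Base using (Fin; zero; suc; punchIn; punchOut)
open import Data.Fin.Patterns using (0F; 1F; 2F)
open import Data.Fin.Properties using (_≟_; any?; punchInᵢ≢i; punchOut-injective)
open import Data.Fin.Subset using (Subset; inside; outside; ∣_∣; _∈_)
open import Data.Maybe.Base using (Maybe; just; nothing; maybe′; is-just)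
import Data.Maybe.Properties as Maybe
open import Data.Nat.Base as ℕ using (ℕ; zero; suc; _+_; _≤_; _<_; z≤n; s≤s)
import Data.Nat.Properties as ℕ
open import Data.Nat.Tactic.RingSolver using (solve-∀)
open import Data.Product.Base using (∃; ∃₂; _×_; _,_; proj₁; proj₂)
open import Data.Rational.Base using (_/_; _*_; _≥_; toℚᵘ)
import Data.Rational.Properties as ℚ
open import Data.Rational.Unnormalised.Base as ℚᵘ using (mkℚᵘ; *≤*)
import Data.Rational.Unnormalised.Properties as ℚᵘ
open import Data.Sum.Base using (_⊎_; inj₁; inj₂; [_,_]′)
open import Data.Vec.Base using ([]; _∷_; count; lookup; tabulate)
open import Data.Vec.Functional using (removeAt; updateAt)
open import Data.Vec.Functional.Properties using (updateAt-updates; updateAt-minimal)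
open import Data.Vec.Properties using (lookup∘tabulate; []=⇒lookup; lookup⇒[]=)
open import Function.Base using (_∘_; const; id; case_of_)
open import Relation.Binary.PropositionalEquality
open import Relation.Nullary using (Dec; yes; no; ¬_; does; contradiction)
open import Relation.Nullary.Decidable
  using (map′; _×-dec_; _⊎-dec_; ¬?; dec-true; dec-false; decidable-stable)

open Algebra.Properties.CommutativeMonoid.Sum ℕ.+-0-commutativeMonoid
  using (sum; sum-cong-≗; ∑-distrib-+; ∑-comm; sum-remove; sum-replicate-zero)
open Algebra.Properties.Semiring.Sum ℕ.+-*-semiring using (*-distribˡ-sum)

-- Charging the uncoloured neighbours leaves two shortfalls. A path end joined to the other end of
-- its path by an uncoloured edge (a gap) has only one uncoloured neighbour that sees both colours,
-- so it holds 2 + 2 of its 5 units; an isolated vertex holds 2 + 6 of its 10. The rest must come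
-- from vertices that are not charged across their own uncoloured edge. To find one near a gap, the
-- gap is slid along the path: each position gives another maximum colouring, in which the vertex
-- next to the gap has become a path end, and a path end has only one possible partner across a gap.
-- This pins down the uncoloured neighbours of successive path vertices until one has no deficient
-- neighbour left. A gap doubled by a parallel uncoloured edge would spoil the count, and the
-- exchange that removes it merely keeps the size; hence the second criterion. Its multiplicity term
-- excludes such double edges, and its other term controls the surroundings of isolated vertices.

-- Finite sums of natural numbers

sum-mono : ∀ {n} {f g : Fin n → ℕ} → (∀ i → f i ≤ g i) → sum f ≤ sum g
sum-mono {zero}  f≤g = z≤n
sum-mono {suc n} f≤g = ℕ.+-mono-≤ (f≤g zero) (sum-mono (f≤g ∘ suc))

-- The equation `sum f - f i = sum g - g i` without subtraction. Recolouring one edge changes a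
-- weight at one index only, so erasing and painting are accounted for in this form.
sum-exchange : ∀ {n} {f g : Fin n → ℕ} i → (∀ j → j ≢ i → f j ≡ g j) →
               sum f + g i ≡ sum g + f i
sum-exchange {suc n} {f} {g} i f≗g = begin
  sum f + g i                       ≡⟨ cong (_+ g i) (sum-remove {i = i} f) ⟩
  f i + sum (removeAt f i) + g i    ≡⟨ cong (λ s → f i + s + g i) (sum-cong-≗ λ j → f≗g (punchIn i j) (punchInᵢ≢i i j)) ⟩
  f i + sum (removeAt g i) + g i    ≡⟨ swap (f i) _ (g i) ⟩
  g i + sum (removeAt g i) + f i    ≡⟨ cong (_+ f i) (sum-remove {i = i} g) ⟨
  sum g + f i                       ∎
  where
  open ≡-Reasoning
  swap : ∀ a b c → a + b + c ≡ c + b + a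
  swap = solve-∀

when : ∀ {p} {P : Set p} → Dec P → ℕ → ℕ
when P? x = if does P? then x else 0

when-true : ∀ {p} {P : Set p} (P? : Dec P) {x} → P → when P? x ≡ x
when-true P? {x} p = cong (λ b → if b then x else 0) (dec-true P? p)

when-false : ∀ {p} {P : Set p} (P? : Dec P) {x} → ¬ P → when P? x ≡ 0
when-false P? {x} ¬p = cong (λ b → if b then x else 0) (dec-false P? ¬p)

when-≤ : ∀ {p} {P : Set p} (P? : Dec P) {x} → when P? x ≤ x
when-≤ (yes _) = ℕ.≤-refl
when-≤ (no _)  = z≤n

when-mono : ∀ {p} {P : Set p} (P? : Dec P) {x y} → x ≤ y → when P? x ≤ when P? y
when-mono (yes _) x≤y = x≤y
when-mono (no _)  x≤y = z≤n

when-⇒ : ∀ {p q} {P : Set p} {Q : Set q} (P? : Dec P) (Q? : Dec Q) {x} → (P → Q) →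
         when P? x ≤ when Q? x
when-⇒ (no _)  _  p⇒q = z≤n
when-⇒ (yes p) Q? p⇒q = ℕ.≤-reflexive (sym (when-true Q? (p⇒q p)))

when-+ : ∀ {p} {P : Set p} (P? : Dec P) x y → when P? (x + y) ≡ when P? x + when P? y
when-+ (yes _) x y = refl
when-+ (no _)  x y = refl

sum-const : ∀ n c → sum {n} (const c) ≡ n ℕ.* c
sum-const zero    c = refl
sum-const (suc n) c = cong (c +_) (sum-const n c)

sum-zero : ∀ {n} {f : Fin n → ℕ} → (∀ i → f i ≡ 0) → sum f ≡ 0
sum-zero {n} f≗0 = trans (sum-cong-≗ f≗0) (sum-replicate-zero n)

without : ∀ {n} → Fin n → (Fin n → ℕ) → Fin n → ℕ
without i f j = when (¬? (j ≟ i)) (f j)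

without-≢ : ∀ {n} {i j : Fin n} f → j ≢ i → without i f j ≡ f j
without-≢ {i = i} {j} f j≢i = when-true (¬? (j ≟ i)) j≢i

sum-split : ∀ {n} (f : Fin n → ℕ) i → sum f ≡ f i + sum (without i f)
sum-split f i = begin
  sum f                        ≡⟨ ℕ.+-identityʳ _ ⟨
  sum f + 0                    ≡⟨ cong (sum f +_) (when-false (¬? (i ≟ i)) λ i≢i → i≢i refl) ⟨
  sum f + without i f i        ≡⟨ sum-exchange i (λ j j≢i → sym (without-≢ f j≢i)) ⟩
  sum (without i f) + f i      ≡⟨ ℕ.+-comm _ (f i) ⟩
  f i + sum (without i f)      ∎
  where open ≡-Reasoning

term≤sum : ∀ {n} (f : Fin n → ℕ) i → f i ≤ sum f
term≤sum f i = subst (f i ≤_) (sym (sum-split f i)) (ℕ.m≤m+n _ _)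

sum-₁ : ∀ {n} {f : Fin n → ℕ} i → (∀ j → j ≢ i → f j ≡ 0) → sum f ≡ f i
sum-₁ {f = f} i f≗0 = trans (sum-split f i) (trans (cong (f i +_) (sum-zero rest)) (ℕ.+-identityʳ _))
  where
  rest : ∀ j → without i f j ≡ 0
  rest j with j ≟ i
  ... | yes _  = refl
  ... | no j≢i = f≗0 j j≢i

sum-₂ : ∀ {n} {f : Fin n → ℕ} {i j} → i ≢ j → (∀ l → l ≢ i → l ≢ j → f l ≡ 0) →
        sum f ≡ f i + f j
sum-₂ {f = f} {i} {j} i≢j f≗0 = trans (sum-split f i)
  (cong (f i +_) (trans (sum-₁ j rest) (without-≢ f (i≢j ∘ sym))))
  where
  rest : ∀ l → l ≢ j → without i f l ≡ 0
  rest l l≢j with l ≟ i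
  ... | yes _  = refl
  ... | no l≢i = f≗0 l l≢i l≢j

sum-₃ : ∀ {n} {f : Fin n → ℕ} {i j k} → i ≢ j → i ≢ k → j ≢ k →
        (∀ l → l ≢ i → l ≢ j → l ≢ k → f l ≡ 0) → sum f ≡ f i + (f j + f k)
sum-₃ {f = f} {i} {j} {k} i≢j i≢k j≢k f≗0 = trans (sum-split f i)
  (cong (f i +_) (trans (sum-₂ j≢k rest)
    (cong₂ _+_ (without-≢ f (i≢j ∘ sym)) (without-≢ f (i≢k ∘ sym)))))
  where
  rest : ∀ l → l ≢ j → l ≢ k → without i f l ≡ 0
  rest l l≢j l≢k with l ≟ i
  ... | yes _  = refl
  ... | no l≢i = f≗0 l l≢i l≢j l≢k

count≡sum : ∀ {n} {P : Fin n → Set} (P? : ∀ i → Dec (P i)) {m} (g : Fin m → Fin n) →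
            count P? (tabulate g) ≡ sum (λ i → when (P? (g i)) 1)
count≡sum P? {zero}  g = refl
count≡sum P? {suc m} g with P? (g zero)
... | yes _ = cong suc (count≡sum P? (g ∘ suc))
... | no _  = count≡sum P? (g ∘ suc)

-- Maximising a bounded function

module _ {A : Set} (f : A → ℕ) {b : ℕ} (f≤b : ∀ a → f a ≤ b) where

  -- Each strict improvement uses up one unit of the slack `k`, so improvements cannot go on for
  -- ever. The double negation spares a search through `A`, and a decidable conclusion can absorb
  -- it.
  ¬¬-argmax : A → ¬ ¬ ∃ λ a → ∀ a′ → f a′ ≤ f a
  ¬¬-argmax a₀ none = climb b a₀ (ℕ.m≤m+n b _)
    where
    climb : ∀ k a → b ≤ k + f a → ⊥
    climb k a b≤k+fa = none (a , higher k b≤k+fa)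
      where
      higher : ∀ k → b ≤ k + f a → ∀ a′ → f a′ ≤ f a
      higher k b≤ a′ with f a′ ℕ.≤? f a
      ... | yes p = p
      higher zero    b≤ a′ | no ¬p = ℕ.≤-trans (f≤b a′) b≤
      higher (suc k) b≤ a′ | no ¬p = ⊥-elim (climb k a′ (ℕ.≤-trans b≤
        (ℕ.≤-trans (ℕ.≤-reflexive (sym (ℕ.+-suc k (f a)))) (ℕ.+-monoʳ-≤ k (ℕ.≰⇒> ¬p)))))

∣∣≡sum : ∀ {n} (p : Subset n) → ∣ p ∣ ≡ sum λ i → if lookup p i then 1 else 0
∣∣≡sum []            = refl
∣∣≡sum (inside  ∷ p) = cong suc (∣∣≡sum p)
∣∣≡sum (outside ∷ p) = ∣∣≡sum p

-- Boolean colours versus colours in `Fin`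

fromBool : Bool → Fin 2
fromBool true  = 0F
fromBool false = 1F

fromBool-injective : ∀ {j k} → fromBool j ≡ fromBool k → j ≡ k
fromBool-injective {true}  {true}  _ = refl
fromBool-injective {false} {false} _ = refl

discard : Fin 3 → Fin 3 → Maybe Bool
discard i x with i ≟ x
... | yes _  = nothing
... | no i≢x = just (does (punchOut i≢x ≟ 0F))

discard-injective : ∀ i x y {k} → discard i x ≡ just k → discard i y ≡ just k → x ≡ y
discard-injective i x y p q with i ≟ x | i ≟ y
... | no i≢x | no i≢y = punchOut-injective i≢x i≢y
  (does-injective (Maybe.just-injective (trans p (sym q))))
  where
  does-injective : ∀ {a b : Fin 2} → does (a ≟ 0F) ≡ does (b ≟ 0F) → a ≡ b
  does-injective {0F} {0F} _ = refl
  does-injective {1F} {1F} _ = refl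

module TwoColourings (G : Graph) (cubic : Cubic G) where

  open Graph G using () renaming
    (Vertex to V; Edge to E; Incident to _∈ᵉ_; incident? to _∈ᵉ?_)

  -- Incidence in a cubic multigraph

  sumAt : V → (E → ℕ) → ℕ
  sumAt v g = sum λ e → when (v ∈ᵉ? e) (g e)

  sumAt-+ : ∀ v f g → sumAt v (λ e → f e + g e) ≡ sumAt v f + sumAt v g
  sumAt-+ v f g = trans (sum-cong-≗ λ e → when-+ (v ∈ᵉ? e) (f e) (g e))
    (∑-distrib-+ (λ e → when (v ∈ᵉ? e) (f e)) _)

  degree≡ : ∀ v → sumAt v (const 1) ≡ 3
  degree≡ v = trans (sym (count≡sum (v ∈ᵉ?_) id)) (cubic v)

  record Star (v : V) (e₁ e₂ e₃ : E) : Set where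
    field
      at₁  : v ∈ᵉ e₁
      at₂  : v ∈ᵉ e₂
      at₃  : v ∈ᵉ e₃
      ≢₁₂  : e₁ ≢ e₂
      ≢₁₃  : e₁ ≢ e₃
      ≢₂₃  : e₂ ≢ e₃
      only : ∀ f → v ∈ᵉ f → f ≡ e₁ ⊎ f ≡ e₂ ⊎ f ≡ e₃

  -- Three distinct edges exhaust the degree sum at `v`; the remainder is zero, so no fourth edge
  -- can contribute to it.
  star : ∀ {v e₁ e₂ e₃} → v ∈ᵉ e₁ → v ∈ᵉ e₂ → v ∈ᵉ e₃ → e₁ ≢ e₂ → e₁ ≢ e₃ → e₂ ≢ e₃ →
         Star v e₁ e₂ e₃
  star {v} {e₁} {e₂} {e₃} a₁ a₂ a₃ d₁₂ d₁₃ d₂₃ = record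
    { at₁ = a₁ ; at₂ = a₂ ; at₃ = a₃ ; ≢₁₂ = d₁₂ ; ≢₁₃ = d₁₃ ; ≢₂₃ = d₂₃ ; only = only }
    where
    open ≡-Reasoning
    d r₁ r₂ r₃ : E → ℕ
    d e = when (v ∈ᵉ? e) 1
    r₁ = without e₁ d
    r₂ = without e₂ r₁
    r₃ = without e₃ r₂
    rest : sum r₃ ≡ 0
    rest = ℕ.+-cancelˡ-≡ 3 (sum r₃) 0 (begin
      1 + (1 + (1 + sum r₃))       ≡⟨ cong₂ (λ a b → a + (b + (1 + sum r₃))) (when-true (v ∈ᵉ? e₁) a₁) (trans (without-≢ d (d₁₂ ∘ sym)) (when-true (v ∈ᵉ? e₂) a₂)) ⟨
      d e₁ + (r₁ e₂ + (1 + sum r₃)) ≡⟨ cong (λ a → d e₁ + (r₁ e₂ + (a + sum r₃))) (trans (without-≢ r₁ (d₂₃ ∘ sym)) (trans (without-≢ d (d₁₃ ∘ sym)) (when-true (v ∈ᵉ? e₃) a₃))) ⟨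
      d e₁ + (r₁ e₂ + (r₂ e₃ + sum r₃)) ≡⟨ cong (λ a → d e₁ + (r₁ e₂ + a)) (sum-split r₂ e₃) ⟨
      d e₁ + (r₁ e₂ + sum r₂)      ≡⟨ cong (d e₁ +_) (sum-split r₁ e₂) ⟨
      d e₁ + sum r₁                ≡⟨ sum-split d e₁ ⟨
      sum d                        ≡⟨ degree≡ v ⟩
      3                            ∎)
    only : ∀ f → v ∈ᵉ f → f ≡ e₁ ⊎ f ≡ e₂ ⊎ f ≡ e₃
    only f a with f ≟ e₁ | f ≟ e₂ | f ≟ e₃
    ... | yes p | _     | _     = inj₁ p
    ... | no _  | yes p | _     = inj₂ (inj₁ p)
    ... | no _  | no _  | yes p = inj₂ (inj₂ p)
    ... | no p  | no q  | no r  = contradiction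
      (begin
        1     ≡⟨ when-true (v ∈ᵉ? f) a ⟨
        d f   ≡⟨ without-≢ d p ⟨
        r₁ f  ≡⟨ without-≢ r₁ q ⟨
        r₂ f  ≡⟨ without-≢ r₂ r ⟨
        r₃ f  ≡⟨ ℕ.n≤0⇒n≡0 (subst (r₃ f ≤_) rest (term≤sum r₃ f)) ⟩
        0     ∎)
      λ ()

  sumAt-star : ∀ {v e₁ e₂ e₃} g → Star v e₁ e₂ e₃ → sumAt v g ≡ g e₁ + (g e₂ + g e₃)
  sumAt-star {v} {e₁} {e₂} {e₃} g s = trans
    (sum-₃ ≢₁₂ ≢₁₃ ≢₂₃ λ l n₁ n₂ n₃ → when-false (v ∈ᵉ? l) λ a →
      [ n₁ , [ n₂ , n₃ ]′ ]′ (only l a))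
    (cong₂ _+_ (when-true (v ∈ᵉ? e₁) at₁)
      (cong₂ _+_ (when-true (v ∈ᵉ? e₂) at₂) (when-true (v ∈ᵉ? e₃) at₃)))
    where open Star s

  star₂ : ∀ {v e₁ e₂} → v ∈ᵉ e₁ → v ∈ᵉ e₂ → e₁ ≢ e₂ → ∃ (Star v e₁ e₂)
  star₂ {v} {e₁} {e₂} a₁ a₂ d
    with any? (λ e → v ∈ᵉ? e ×-dec ¬? (e₁ ≟ e) ×-dec ¬? (e₂ ≟ e))
  ... | yes (e , a , p , q) = e , star a₁ a₂ a d p q
  ... | no none = contradiction (trans (sym (degree≡ v)) (trans
    (sum-₂ d λ l n₁ n₂ → when-false (v ∈ᵉ? l) λ a → none (l , a , n₁ ∘ sym , n₂ ∘ sym))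
    (cong₂ _+_ (when-true (v ∈ᵉ? e₁) a₁) (when-true (v ∈ᵉ? e₂) a₂)))) λ ()

  star₁ : ∀ {v e₁} → v ∈ᵉ e₁ → ∃₂ (Star v e₁)
  star₁ {v} {e₁} a₁ with any? (λ e → v ∈ᵉ? e ×-dec ¬? (e₁ ≟ e))
  ... | yes (e , a , p) = e , star₂ a₁ a p
  ... | no none = contradiction (trans (sym (degree≡ v)) (trans
    (sum-₁ e₁ λ l n₁ → when-false (v ∈ᵉ? l) λ a → none (l , a , n₁ ∘ sym))
    (when-true (v ∈ᵉ? e₁) a₁))) λ ()

  star₀ : ∀ v → ∃ λ e₁ → ∃₂ (Star v e₁)
  star₀ v with any? (v ∈ᵉ?_)
  ... | yes (e , a) = e , star₁ a
  ... | no none = contradiction (trans (sym (degree≡ v))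
    (sum-zero λ l → when-false (v ∈ᵉ? l) λ a → none (l , a))) λ ()

  -- Meaningful only if `v` is an end of `e`; for any other `v` the value is the first end.
  other : V → E → V
  other v e = if does (v ≟ proj₁ (ends G e)) then proj₂ (ends G e) else proj₁ (ends G e)

  Joins : E → V → V → Set
  Joins e a b = a ≢ b × a ∈ᵉ e × b ∈ᵉ e

  joins-sym : ∀ {e a b} → Joins e a b → Joins e b a
  joins-sym (a≢b , p , q) = a≢b ∘ sym , q , p

  joins-other : ∀ {v e} → v ∈ᵉ e → Joins e v (other v e)
  joins-other {v} {e} a with v ≟ proj₁ (ends G e)
  ... | yes refl = loopless G e , inj₁ refl , inj₂ refl
  joins-other {v} {e} (inj₁ p) | no v≢ = contradiction p v≢
  joins-other {v} {e} (inj₂ p) | no v≢ = v≢ , inj₂ p , inj₁ refl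

  joins-only : ∀ {e a b} → Joins e a b → ∀ {w} → w ∈ᵉ e → w ≡ a ⊎ w ≡ b
  joins-only (a≢b , inj₁ p , inj₁ q) _ = contradiction (trans p (sym q)) a≢b
  joins-only (a≢b , inj₂ p , inj₂ q) _ = contradiction (trans p (sym q)) a≢b
  joins-only (a≢b , inj₁ p , inj₂ q) (inj₁ r) = inj₁ (trans r (sym p))
  joins-only (a≢b , inj₁ p , inj₂ q) (inj₂ r) = inj₂ (trans r (sym q))
  joins-only (a≢b , inj₂ p , inj₁ q) (inj₁ r) = inj₂ (trans r (sym q))
  joins-only (a≢b , inj₂ p , inj₁ q) (inj₂ r) = inj₁ (trans r (sym p))

  joins⇒other : ∀ {e a b} → Joins e a b → other a e ≡ b
  joins⇒other {e} {a} ab@(_ , a∈e , _) with joins-other {a} {e} a∈e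
  ... | a≢o , _ , o∈e = [ (λ o≡a → contradiction (sym o≡a) a≢o) , id ]′ (joins-only ab o∈e)

  joins-unique : ∀ {e a b b′} → Joins e a b → Joins e a b′ → b ≡ b′
  joins-unique ab ab′ = trans (sym (joins⇒other ab)) (joins⇒other ab′)

  handshake : (B : V → E → ℕ) →
              sum (λ v → sumAt v (B v)) ≡ sum (λ e → B (proj₁ (ends G e)) e + B (proj₂ (ends G e)) e)
  handshake B = trans (∑-comm λ v e → when (v ∈ᵉ? e) (B v e)) (sum-cong-≗ λ e → trans
    (sum-₂ (loopless G e) λ v n₁ n₂ → when-false (v ∈ᵉ? e) [ n₁ , n₂ ]′)
    (cong₂ _+_ (when-true (_ ∈ᵉ? e) (inj₁ refl)) (when-true (_ ∈ᵉ? e) (inj₂ refl))))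

  -- Every edge is counted from both of its ends on either side, only with the ends interchanged.
  -- Hence all transfers cancel when local balances are added up.
  inflow≡outflow : (B : V → E → ℕ) →
                   sum (λ v → sumAt v λ e → B (other v e) e) ≡ sum (λ v → sumAt v (B v))
  inflow≡outflow B = begin
    sum (λ v → sumAt v λ e → B (other v e) e)                           ≡⟨ handshake (λ v e → B (other v e) e) ⟩
    sum (λ e → B (other (tail e) e) e + B (other (head e) e) e)         ≡⟨ sum-cong-≗ (λ e → trans (cong₂ (λ a b → B a e + B b e) (joins⇒other (tail-head e)) (joins⇒other (joins-sym (tail-head e)))) (ℕ.+-comm (B (head e) e) _)) ⟩
    sum (λ e → B (tail e) e + B (head e) e)                             ≡⟨ handshake B ⟨
    sum (λ v → sumAt v (B v))                                           ∎
    where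
    open ≡-Reasoning
    tail head : E → V
    tail e = proj₁ (ends G e)
    head e = proj₂ (ends G e)
    tail-head : ∀ e → Joins e (tail e) (head e)
    tail-head e = loopless G e , inj₁ refl , inj₂ refl

  -- Partial colourings with two colours

  record Colouring : Set where
    field
      hue    : E → Maybe Bool
      proper : ∀ {v e f k} → v ∈ᵉ e → v ∈ᵉ f → hue e ≡ just k → hue f ≡ just k → e ≡ f

  open Colouring

  Sees Misses : Colouring → V → Bool → Set
  Sees C v k = ∃ λ e → v ∈ᵉ e × hue C e ≡ just k
  Misses C v k = ∀ e → v ∈ᵉ e → hue C e ≢ just k

  Deficient Isolated : Colouring → V → Set
  Deficient C v = ∃ (Misses C v)
  Isolated C v = ∀ k → Misses C v k

  opaque
    sees? : ∀ C v k → Dec (Sees C v k)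
    sees? C v k = any? λ e → v ∈ᵉ? e ×-dec Maybe.≡-dec Bool._≟_ (hue C e) (just k)

  opaque
    misses? : ∀ C v k → Dec (Misses C v k)
    misses? C v k = map′ (λ ¬s e a p → ¬s (e , a , p)) (λ m (e , a , p) → m e a p) (¬? (sees? C v k))

  ∃Bool? : ∀ {P : Bool → Set} → (∀ k → Dec (P k)) → Dec (∃ P)
  ∃Bool? P? = map′ [ true ,_ , false ,_ ]′
    (λ { (true , p) → inj₁ p ; (false , p) → inj₂ p }) (P? true ⊎-dec P? false)

  ∀Bool? : ∀ {P : Bool → Set} → (∀ k → Dec (P k)) → Dec (∀ k → P k)
  ∀Bool? P? = map′ (λ { (p , q) true → p ; (p , q) false → q }) (λ p → p true , p false)
    (P? true ×-dec P? false)

  opaque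
    deficient? : ∀ C v → Dec (Deficient C v)
    deficient? C v = ∃Bool? (misses? C v)

  opaque
    isolated? : ∀ C v → Dec (Isolated C v)
    isolated? C v = ∀Bool? (misses? C v)

  ¬misses⇒sees : ∀ C {v k} → ¬ Misses C v k → Sees C v k
  ¬misses⇒sees C {v} {k} ¬m with sees? C v k
  ... | yes s = s
  ... | no ¬s = contradiction (λ e a p → ¬s (e , a , p)) ¬m

  sees-misses : ∀ C {v k} → Sees C v k → ¬ Misses C v k
  sees-misses C (e , a , p) m = m e a p

  ¬not≡ : ∀ k → k ≢ not k
  ¬not≡ k = not-¬ refl

  apart : ∀ C {e f k} → hue C e ≡ nothing → hue C f ≡ just k → e ≢ f
  apart C p q refl with () ← trans (sym p) q

  differ : ∀ C {e f k} → hue C e ≡ just k → hue C f ≡ just (not k) → e ≢ f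
  differ C {k = k} p q refl = ¬not≡ k (Maybe.just-injective (trans (sym p) q))

  shade : Maybe Bool → ℕ → ℕ
  shade h x = maybe′ (const x) 0 h

  weight : (E → ℕ) → Colouring → ℕ
  weight w C = sum λ e → shade (hue C e) (w e)

  size : Colouring → ℕ
  size = weight (const 1)

  -- Recolouring a single edge or a whole path

  module Erase (C : Colouring) (e : E) where

    hue′ : E → Maybe Bool
    hue′ = updateAt (hue C) e (const nothing)

    at : hue′ e ≡ nothing
    at = updateAt-updates e (hue C)

    off : ∀ {f} → f ≢ e → hue′ f ≡ hue C f
    off {f} = updateAt-minimal f e (hue C)

    just⁻ : ∀ {f k} → hue′ f ≡ just k → f ≢ e × hue C f ≡ just k
    just⁻ {f} p with f ≟ e
    ... | yes refl with () ← trans (sym at) p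
    ... | no f≢e = f≢e , trans (sym (off f≢e)) p

    colouring : Colouring
    colouring = record
      { hue = hue′
      ; proper = λ a b p q → proper C a b (proj₂ (just⁻ p)) (proj₂ (just⁻ q))
      }

    misses : ∀ {v k} → Misses C v k → Misses colouring v k
    misses m f a p = m f a (proj₂ (just⁻ p))

    frees : ∀ {v k} → hue C e ≡ just k → v ∈ᵉ e → Misses colouring v k
    frees p a f b q = proj₁ (just⁻ q) (proper C b a (proj₂ (just⁻ q)) p)

    sees⁻ : ∀ {v k} → Sees colouring v k → Sees C v k
    sees⁻ (f , a , p) = f , a , proj₂ (just⁻ p)

    weight-erase : ∀ w {k} → hue C e ≡ just k → weight w colouring + w e ≡ weight w C
    weight-erase w p = begin
      weight w colouring + w e                     ≡⟨ cong (λ h → weight w colouring + shade h (w e)) p ⟨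
      weight w colouring + shade (hue C e) (w e)   ≡⟨ sum-exchange e (λ f f≢e → cong (λ h → shade h (w f)) (off f≢e)) ⟩
      weight w C + shade (hue′ e) (w e)            ≡⟨ cong (λ h → weight w C + shade h (w e)) at ⟩
      weight w C + 0                               ≡⟨ ℕ.+-identityʳ _ ⟩
      weight w C                                   ∎
      where open ≡-Reasoning

  module Paint (C : Colouring) (e : E) (k : Bool) {a b : V} (ab : Joins e a b)
               (ma : Misses C a k) (mb : Misses C b k) where

    hue′ : E → Maybe Bool
    hue′ = updateAt (hue C) e (const (just k))

    at : hue′ e ≡ just k
    at = updateAt-updates e (hue C)

    off : ∀ {f} → f ≢ e → hue′ f ≡ hue C f
    off {f} = updateAt-minimal f e (hue C)

    just⁻ : ∀ {f j} → hue′ f ≡ just j → (f ≡ e × j ≡ k) ⊎ (f ≢ e × hue C f ≡ just j)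
    just⁻ {f} p with f ≟ e
    ... | yes refl = inj₁ (refl , Maybe.just-injective (trans (sym p) at))
    ... | no f≢e = inj₂ (f≢e , trans (sym (off f≢e)) p)

    ends-miss : ∀ {v} → v ∈ᵉ e → Misses C v k
    ends-miss v∈e with joins-only ab v∈e
    ... | inj₁ refl = ma
    ... | inj₂ refl = mb

    colouring : Colouring
    colouring = record { hue = hue′ ; proper = proper′ }
      where
      proper′ : ∀ {v f g j} → v ∈ᵉ f → v ∈ᵉ g → hue′ f ≡ just j → hue′ g ≡ just j → f ≡ g
      proper′ v∈f v∈g p q with just⁻ p | just⁻ q
      ... | inj₁ (refl , refl) | inj₁ (refl , _)    = refl
      ... | inj₁ (refl , refl) | inj₂ (_ , q′)      = contradiction q′ (ends-miss v∈f _ v∈g)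
      ... | inj₂ (_ , p′)      | inj₁ (refl , refl) = contradiction p′ (ends-miss v∈g _ v∈f)
      ... | inj₂ (_ , p′)      | inj₂ (_ , q′)      = proper C v∈f v∈g p′ q′

    misses : ∀ {v j} → j ≢ k → Misses C v j → Misses colouring v j
    misses j≢k m f v∈f p with just⁻ p
    ... | inj₁ (_ , j≡k) = j≢k j≡k
    ... | inj₂ (_ , p′)  = m f v∈f p′

    misses-away : ∀ {v j} → ¬ v ∈ᵉ e → Misses C v j → Misses colouring v j
    misses-away v∉e m f v∈f p with just⁻ p
    ... | inj₁ (refl , _) = v∉e v∈f
    ... | inj₂ (_ , p′)   = m f v∈f p′

    sees : ∀ {v j} → hue C e ≡ nothing → Sees C v j → Sees colouring v j
    sees blank (f , v∈f , p) = f , v∈f , trans (off (apart C blank p ∘ sym)) p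

    weight-paint : ∀ w → hue C e ≡ nothing → weight w colouring ≡ weight w C + w e
    weight-paint w p = begin
      weight w colouring                           ≡⟨ ℕ.+-identityʳ _ ⟨
      weight w colouring + 0                       ≡⟨ cong (λ h → weight w colouring + shade h (w e)) p ⟨
      weight w colouring + shade (hue C e) (w e)   ≡⟨ sum-exchange e (λ f f≢e → cong (λ h → shade h (w f)) (off f≢e)) ⟩
      weight w C + shade (hue′ e) (w e)            ≡⟨ cong (λ h → weight w C + shade h (w e)) at ⟩
      weight w C + w e                             ∎
      where open ≡-Reasoning

  -- Interchanging the two colours along the path that starts with the coloured
  -- edge at u.
  record Switch (C : Colouring) (u : V) (k : Bool) : Set where
    field
      partner   : V
      result    : Colouring
      distinct  : u ≢ partner
      partnered : ∃ (Sees C partner)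
      same-size : size result ≡ size C
      blank     : ∀ {e} → hue C e ≡ nothing → hue result e ≡ nothing
      freed     : Misses result u k
      stable    : ∀ {w j} → w ≢ u → w ≢ partner → Misses C w j → Misses result w j

  -- Remove the edge at u, switch at its other end, and put it back in the other colour.
  switch : ∀ n C {u k} → size C < n → Sees C u k → Misses C u (not k) → Switch C u k
  switch (suc n) C {u} {k} (s≤s size≤n) (e , u∈e , p) mu = answer
    where
    x : V
    x = other u e
    ux : Joins e u x
    ux = joins-other u∈e
    u≢x : u ≢ x
    u≢x = proj₁ ux
    x∈e : x ∈ᵉ e
    x∈e = proj₂ (proj₂ ux)
    module E₁ = Erase C e
    C₁ : Colouring
    C₁ = E₁.colouring
    size₁ : size C₁ + 1 ≡ size C
    size₁ = E₁.weight-erase (const 1) p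
    u-bare : ∀ j → Misses C₁ u j
    u-bare j with j Bool.≟ k
    ... | yes refl = E₁.frees p u∈e
    ... | no j≢k = subst (Misses C₁ u) (sym (¬-not j≢k)) (E₁.misses mu)

    answer : Switch C u k
    answer with misses? C x (not k)
    ... | yes mx = record
      { partner = x ; result = P.colouring ; distinct = u≢x ; partnered = k , e , x∈e , p
      ; same-size = trans (P.weight-paint (const 1) E₁.at) size₁
      ; blank = λ q → trans (P.off (apart C q p)) (trans (E₁.off (apart C q p)) q)
      ; freed = P.misses (¬not≡ k) (u-bare k)
      ; stable = λ w≢u w≢x m →
          P.misses-away (λ w∈e → [ w≢u , w≢x ]′ (joins-only ux w∈e)) (E₁.misses m)
      }
      where module P = Paint C₁ e (not k) ux (u-bare (not k)) (E₁.misses mx)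
    ... | no ¬mx = record
      { partner = S.partner ; result = P.colouring ; distinct = u≢partner
      ; partnered = proj₁ S.partnered , E₁.sees⁻ (proj₂ S.partnered)
      ; same-size = trans (P.weight-paint (const 1) (S.blank E₁.at))
          (trans (cong (_+ 1) S.same-size) size₁)
      ; blank = λ q → trans (P.off (apart C q p)) (S.blank (trans (E₁.off (apart C q p)) q))
      ; freed = P.misses (¬not≡ k) (u-result k)
      ; stable = stable′
      }
      where
      x-sees : Sees C x (not k)
      x-sees = ¬misses⇒sees C ¬mx
      x-sees₁ : Sees C₁ x (not k)
      x-sees₁ with f , x∈f , q ← x-sees = f , x∈f , trans (E₁.off (differ C p q ∘ sym)) q
      x-misses₁ : Misses C₁ x (not (not k))
      x-misses₁ = subst (Misses C₁ x) (sym (not-involutive k)) (E₁.frees p x∈e)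
      -- Without `e`, the vertex `x` is the end of a shorter path that starts in the other colour,
      -- and the size has dropped by one.
      module S = Switch (switch n C₁ (ℕ.≤-trans (ℕ.≤-reflexive (trans (ℕ.+-comm 1 _) size₁)) size≤n) x-sees₁ x-misses₁)
      -- The path from `x` cannot end in `u`: the erasure has left `u` without coloured edges,
      -- whereas `partnered` provides one at the far end.
      u≢partner : u ≢ S.partner
      u≢partner u≡ = sees-misses C₁ (proj₂ S.partnered) (subst (λ w → Misses C₁ w (proj₁ S.partnered)) u≡ (u-bare (proj₁ S.partnered)))
      u-result : ∀ j → Misses S.result u j
      u-result j = S.stable u≢x u≢partner (u-bare j)
      module P = Paint S.result e (not k) ux (u-result (not k)) S.freed
      stable′ : ∀ {w j} → w ≢ u → w ≢ S.partner → Misses C w j → Misses P.colouring w j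
      stable′ {w} {j} w≢u w≢partner m with w ≟ x
      ... | no w≢x = P.misses-away (λ w∈e → [ w≢u , w≢x ]′ (joins-only ux w∈e))
        (S.stable w≢x w≢partner (E₁.misses m))
      -- In `C` the vertex `x` sees both colours, so it misses nothing that would have to be
      -- preserved.
      ... | yes refl with j Bool.≟ k
      ...   | yes refl = contradiction m (sees-misses C (e , x∈e , p))
      ...   | no j≢k   = contradiction (subst (Misses C x) (¬-not j≢k) m) (sees-misses C x-sees)

  -- Gaps in maximum colourings

  Maximum : Colouring → Set
  Maximum C = ∀ C′ → size C′ ≤ size C

  maximum-≡ : ∀ C C′ → Maximum C → size C′ ≡ size C → Maximum C′
  maximum-≡ C C′ max eq D = subst (size D ≤_) (sym eq) (max D)

  no-common : ∀ C {e a b k} → Maximum C → Joins e a b → hue C e ≡ nothing →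
              Misses C a k → ¬ Misses C b k
  no-common C {e} max ab blank ma mb = ℕ.1+n≰n (subst (_≤ size C)
    (trans (P.weight-paint (const 1) blank) (ℕ.+-comm _ 1)) (max P.colouring))
    where module P = Paint C e _ ab ma mb

  record OpenEdge (C : Colouring) (e : E) (a b : V) : Set where
    constructor openEdge
    field
      joins : Joins e a b
      blank : hue C e ≡ nothing
      def₁  : Deficient C a
      def₂  : Deficient C b

  record Polar (C : Colouring) (a b : V) (k : Bool) : Set where
    constructor polar
    field
      sees₁   : Sees C a k
      misses₁ : Misses C a (not k)
      misses₂ : Misses C b k
      sees₂   : Sees C b (not k)

  -- A common free colour could be given to `e`, so the ends miss different colours and neither is
  -- isolated. The path between them therefore has even length and closes up with `e` to an odd
  -- cycle.
  polarised : ∀ C {e a b} → Maximum C → OpenEdge C e a b → ∃ (Polar C a b)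
  polarised C {a = a} {b} max (openEdge ab blank (j , ma) (k , mb)) = k , record
    { sees₁ = ¬misses⇒sees C λ m → no-common C max ab blank m mb
    ; misses₁ = ma′
    ; misses₂ = mb
    ; sees₂ = ¬misses⇒sees C (no-common C max ab blank ma′)
    }
    where
    ma′ : Misses C a (not k)
    ma′ = subst (Misses C a) (¬-not λ { refl → no-common C max ab blank ma mb }) ma

  -- Otherwise switching at u would leave u and its neighbour a common free colour.
  open⇒partner : ∀ C {e u a k} (S : Switch C u k) → Maximum C → OpenEdge C e u a →
                 Sees C u k → a ≡ Switch.partner S
  open⇒partner C {e} {u} {a} {k} S max o su with polarised C max o
  ... | j , polar _ m₁ m₂ _ with a ≟ Switch.partner S
  ...   | yes a≡ = a≡
  ...   | no a≢ = contradiction (subst (λ k → Misses result a k) (sym k≡j) (stable (proj₁ (joins-sym joins)) a≢ m₂))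
    (no-common result (maximum-≡ C result max same-size) joins (S.blank blank) freed)
    where
    module S = Switch S
    open Switch S hiding (blank)
    open OpenEdge o
    k≡j : k ≡ j
    k≡j with k Bool.≟ j
    ... | yes p = p
    ... | no k≢j = contradiction (subst (Misses C u) (sym (¬-not k≢j)) m₁) (sees-misses C su)

  -- The vertex across a gap at `u` has to be the far end of the path that starts in `u`, and this
  -- path does not depend on the gap.
  open-unique : ∀ C {e f u a b} → Maximum C → OpenEdge C e u a → OpenEdge C f u b → a ≡ b
  open-unique C {u = u} max o o′ with polarised C max o
  ... | k , polar su mu _ _ = trans (open⇒partner C S max o su) (sym (open⇒partner C S max o′ su))
    where
    S : Switch C u k
    S = switch _ C ℕ.≤-refl su mu

  -- Sliding the gap e between the ends u and u′ of a path along the path: it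
  -- moves to the coloured edge h at u.
  record Rotation (C : Colouring) (e : E) (u u′ : V) : Set where
    field
      k         : Bool
      polarity  : Polar C u u′ k
      h         : E
      x         : V
      h-joins   : Joins h x u
      h-hue     : hue C h ≡ just k
      x≢u′      : x ≢ u′
      x-sees    : ∀ j → Sees C x j
      next      : Colouring
      next-max  : Maximum next
      next-e    : hue next e ≡ just k
      next-h    : hue next h ≡ nothing
      next-off  : ∀ {f} → f ≢ e → f ≢ h → hue next f ≡ hue C f
      next-open : OpenEdge next h x u
      persists  : ∀ {w} → w ≢ u′ → Deficient C w → Deficient next w
      confined  : ∀ {f w} → Joins f x w → hue C f ≡ nothing → Deficient C w → w ≡ u ⊎ w ≡ u′

  rotate : ∀ C {e u u′} → Maximum C → OpenEdge C e u u′ → Rotation C e u u′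
  rotate C {e} {u} {u′} max o with polarised C max o
  ... | k , π@(polar (h , u∈h , p) mu mu′ su′) = record
    { k = k ; polarity = π ; h = h ; x = x ; h-joins = xu ; h-hue = p ; x≢u′ = x≢u′
    ; x-sees = x-sees ; next = P.colouring ; next-max = next-max ; next-e = P.at
    ; next-h = next-h ; next-off = λ f≢e f≢h → trans (P.off f≢e) (E₁.off f≢h)
    ; next-open = next-open ; persists = persists ; confined = confined }
    where
    open OpenEdge o
    x : V
    x = other u h
    ux : Joins h u x
    ux = joins-other u∈h
    xu : Joins h x u
    xu = joins-sym ux
    x∈h : x ∈ᵉ h
    x∈h = proj₂ (proj₂ ux)
    e≢h : e ≢ h
    e≢h = apart C blank p
    x≢u′ : x ≢ u′
    x≢u′ refl = mu′ h x∈h p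
    x∉e : ¬ x ∈ᵉ e
    x∉e x∈e = [ proj₁ xu , x≢u′ ]′ (joins-only joins x∈e)
    module E₁ = Erase C h
    module P = Paint E₁.colouring e k joins (E₁.frees p u∈h) (E₁.misses mu′)
    next-max : Maximum P.colouring
    next-max = maximum-≡ C P.colouring max (trans
      (P.weight-paint (const 1) (trans (E₁.off e≢h) blank))
      (E₁.weight-erase (const 1) p))
    next-h : hue P.colouring h ≡ nothing
    next-h = trans (P.off (e≢h ∘ sym)) E₁.at
    u-def : Misses P.colouring u (not k)
    u-def = P.misses (¬not≡ k ∘ sym) (E₁.misses mu)
    next-open : OpenEdge P.colouring h x u
    next-open = openEdge xu next-h (k , P.misses-away x∉e (E₁.frees p x∈h)) (not k , u-def)
    -- The colouring after the slide is maximum too, and in it `u` misses `not k` across the gap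
    -- `h`; so `x` cannot miss `not k` as well.
    x-sees : ∀ j → Sees C x j
    x-sees j with j Bool.≟ k
    ... | yes refl = h , x∈h , p
    ... | no j≢k = subst (Sees C x) (sym (¬-not j≢k)) (¬misses⇒sees C λ m →
      no-common P.colouring next-max xu next-h (P.misses-away x∉e (E₁.misses m)) u-def)
    persists : ∀ {w} → w ≢ u′ → Deficient C w → Deficient P.colouring w
    persists {w} w≢u′ (j , m) with w ≟ u
    ... | yes refl = not k , u-def
    ... | no w≢u = j , P.misses-away (λ w∈e → [ w≢u , w≢u′ ]′ (joins-only joins w∈e)) (E₁.misses m)
    -- After the slide `x` is deficient, so an uncoloured edge from `x` to a deficient vertex is a
    -- gap there, and all gaps at `x` lead to `u`. Only `u′` may have lost its deficiency in the
    -- slide.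
    confined : ∀ {f w} → Joins f x w → hue C f ≡ nothing → Deficient C w → w ≡ u ⊎ w ≡ u′
    confined {f} {w} xw q dw with w ≟ u′
    ... | yes w≡u′ = inj₂ w≡u′
    ... | no w≢u′ = inj₁ (open-unique P.colouring next-max
      (openEdge xw (trans (P.off f≢e) (trans (E₁.off (apart C q p)) q)) (OpenEdge.def₁ next-open) (persists w≢u′ dw))
      next-open)
      where
      f≢e : f ≢ e
      f≢e refl = x∉e (proj₁ (proj₂ xw))

  -- Parallel edges, isolated vertices and merit

  Multiple : E → Set
  Multiple e = ∃ λ f → f ≢ e × proj₁ (ends G e) ∈ᵉ f × proj₂ (ends G e) ∈ᵉ f

  opaque
    multiple? : ∀ e → Dec (Multiple e)
    multiple? e = any? λ f → ¬? (f ≟ e) ×-dec proj₁ (ends G e) ∈ᵉ? f ×-dec proj₂ (ends G e) ∈ᵉ? f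

  parallel⇒multiple : ∀ {e f a b} → Joins e a b → Joins f a b → f ≢ e → Multiple e
  parallel⇒multiple {e} {f} ab (_ , a∈f , b∈f) f≢e = f , f≢e , end (inj₁ refl) , end (inj₂ refl)
    where
    end : ∀ {w} → w ∈ᵉ e → w ∈ᵉ f
    end w∈e with joins-only ab w∈e
    ... | inj₁ refl = a∈f
    ... | inj₂ refl = b∈f

  multiple⇒parallel : ∀ {e a b} → Multiple e → Joins e a b → ∃ λ f → f ≢ e × Joins f a b
  multiple⇒parallel {e} (f , f≢e , p , q) (a≢b , a∈e , b∈e) = f , f≢e , a≢b , end a∈e , end b∈e
    where
    end : ∀ {w} → w ∈ᵉ e → w ∈ᵉ f
    end (inj₁ refl) = p
    end (inj₂ refl) = q

  -- An exchange may isolate two vertices, so a parallel edge must outweigh these.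
  multiplicity : E → ℕ
  multiplicity e = when (multiple? e) 3

  Social : Colouring → V → Set
  Social C v = ∃ (Sees C v)

  opaque
    social? : ∀ C v → Dec (Social C v)
    social? C v = ∃Bool? (sees? C v)

  social⇒¬isolated : ∀ C {v} → Social C v → ¬ Isolated C v
  social⇒¬isolated C (k , s) iso = sees-misses C s (iso k)

  sociality : Colouring → ℕ
  sociality C = sum λ v → when (social? C v) 1

  -- The exceptional vertices `x` and `y` may coincide, so the bound also serves an exchange that
  -- endangers a single vertex.
  sociality-loss : ∀ C C′ x y → (∀ {v} → v ≢ x → v ≢ y → Social C v → Social C′ v) →
                   sociality C ≤ sociality C′ + 2
  sociality-loss C C′ x y keep = begin
    sociality C                                          ≤⟨ sum-mono pointwise ⟩
    sum (λ v → when (social? C′ v) 1 + (δ x v + δ y v))  ≡⟨ ∑-distrib-+ _ (λ v → δ x v + δ y v) ⟩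
    sociality C′ + sum (λ v → δ x v + δ y v)             ≡⟨ cong (sociality C′ +_) (∑-distrib-+ (δ x) (δ y)) ⟩
    sociality C′ + (sum (δ x) + sum (δ y))               ≡⟨ cong (sociality C′ +_) (cong₂ _+_ (sum-δ x) (sum-δ y)) ⟩
    sociality C′ + 2                                     ∎
    where
    open ℕ.≤-Reasoning
    δ : V → V → ℕ
    δ x v = when (v ≟ x) 1
    sum-δ : ∀ x → sum (δ x) ≡ 1
    sum-δ x = trans (sum-₁ x λ v v≢x → when-false (v ≟ x) v≢x) (when-true (x ≟ x) refl)
    pointwise : ∀ v → when (social? C v) 1 ≤ when (social? C′ v) 1 + (δ x v + δ y v)
    pointwise v with v ≟ x | v ≟ y
    ... | yes _ | _ = ℕ.≤-trans (when-≤ (social? C v)) (ℕ.≤-trans (s≤s z≤n) (ℕ.m≤n+m _ _))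
    ... | no _  | yes _ = ℕ.≤-trans (when-≤ (social? C v)) (ℕ.m≤n+m _ _)
    ... | no v≢x | no v≢y = ℕ.≤-trans (when-⇒ (social? C v) (social? C′ v) (keep v≢x v≢y)) (ℕ.m≤m+n _ _)

  sociality-gain : ∀ C C′ {x} → ¬ Social C x → Social C′ x → (∀ {v} → Social C v → Social C′ v) →
                   sociality C + 1 ≤ sociality C′
  sociality-gain C C′ {x} ¬s s′ keep = begin
    sociality C + 1                                ≡⟨ cong (sociality C +_) (sum-δ) ⟨
    sociality C + sum δ                            ≡⟨ ∑-distrib-+ _ δ ⟨
    sum (λ v → when (social? C v) 1 + δ v)         ≤⟨ sum-mono pointwise ⟩
    sociality C′                                   ∎
    where
    open ℕ.≤-Reasoning
    δ : V → ℕ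
    δ v = when (v ≟ x) 1
    sum-δ : sum δ ≡ 1
    sum-δ = trans (sum-₁ x λ v v≢x → when-false (v ≟ x) v≢x) (when-true (x ≟ x) refl)
    pointwise : ∀ v → when (social? C v) 1 + δ v ≤ when (social? C′ v) 1
    pointwise v with v ≟ x
    ... | yes refl = ℕ.≤-reflexive (trans (cong (_+ 1) (when-false (social? C x) ¬s)) (sym (when-true (social? C′ x) s′)))
    ... | no _ = subst (_≤ when (social? C′ v) 1) (sym (ℕ.+-identityʳ _))
      (when-⇒ (social? C v) (social? C′ v) keep)

  merit : Colouring → ℕ
  merit C = weight multiplicity C + sociality C

  record Optimal (C : Colouring) : Set where
    field
      max  : Maximum C
      best : ∀ C′ → size C′ ≡ size C → merit C′ ≤ merit C

  -- Exchanges excluded by optimality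

  module Optimality (C : Colouring) (optimal : Optimal C) where
    open Optimal optimal

    -- Trade the coloured edges `h` and `h′` at the two ends for `e` and `e′`. The new edges are
    -- parallel and the old ones are not, which is worth 6, while only the far ends of `h` and `h′`
    -- can become isolated, at a cost of at most 2.
    no-double-gap : ∀ {e e′ u u′} → e ≢ e′ → OpenEdge C e u u′ → ¬ OpenEdge C e′ u u′
    no-double-gap {e} {e′} {u} {u′} e≢e′ o o′ with polarised C max o
    ... | k , polar (h , u∈h , p) mu mu′ (h′ , u′∈h′ , p′) = ℕ.<⇒≱ better (best P₄.colouring same)
      where
      open OpenEdge o
      open OpenEdge o′ using () renaming (joins to joins′; blank to blank′)
      u∈e′ = proj₁ (proj₂ joins′)
      u′∈e′ = proj₂ (proj₂ joins′)
      h′≢h : h′ ≢ h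
      h′≢h = differ C p p′ ∘ sym
      module E₁ = Erase C h
      p′₁ : hue E₁.colouring h′ ≡ just (not k)
      p′₁ = trans (E₁.off h′≢h) p′
      module E₂ = Erase E₁.colouring h′
      blank₂ : ∀ {f} → hue C f ≡ nothing → hue E₂.colouring f ≡ nothing
      blank₂ q = trans (E₂.off (apart C q p′)) (trans (E₁.off (apart C q p)) q)
      module P₃ = Paint E₂.colouring e k joins
        (E₂.misses (E₁.frees p u∈h)) (E₂.misses (E₁.misses mu′))
      module P₄ = Paint P₃.colouring e′ (not k) joins′
        (P₃.misses (¬not≡ k ∘ sym) (E₂.misses (E₁.misses mu)))
        (P₃.misses (¬not≡ k ∘ sym) (E₂.frees p′₁ u′∈h′))
      blank₄ : hue P₃.colouring e′ ≡ nothing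
      blank₄ = trans (P₃.off (e≢e′ ∘ sym)) (blank₂ blank′)

      tally : ∀ w → weight w P₄.colouring + (w h + w h′) ≡ weight w C + (w e + w e′)
      tally w = begin
        weight w P₄.colouring + (w h + w h′)            ≡⟨ cong (_+ (w h + w h′)) (trans (P₄.weight-paint w blank₄) (cong (_+ w e′) (P₃.weight-paint w (blank₂ blank)))) ⟩
        weight w E₂.colouring + w e + w e′ + (w h + w h′) ≡⟨ shuffle (weight w E₂.colouring) (w e) (w e′) (w h) (w h′) ⟩
        weight w E₂.colouring + w h′ + w h + (w e + w e′) ≡⟨ cong (λ s → s + w h + (w e + w e′)) (E₂.weight-erase w p′₁) ⟩
        weight w E₁.colouring + w h + (w e + w e′)       ≡⟨ cong (_+ (w e + w e′)) (E₁.weight-erase w p) ⟩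
        weight w C + (w e + w e′)                        ∎
        where
        open ≡-Reasoning
        shuffle : ∀ a b c d e → a + b + c + (d + e) ≡ a + e + d + (b + c)
        shuffle = solve-∀

      same : size P₄.colouring ≡ size C
      same = ℕ.+-cancelʳ-≡ 2 (size P₄.colouring) (size C) (tally (const 1))

      -- The edges `e`, `e′` and `h` use up the degree of `u`, so an edge parallel to `h` would be
      -- `e` or `e′` and force `h` to end in `u′`.
      simple : ∀ {h u u′} → Joins e u u′ → Joins e′ u u′ → (u∈h : u ∈ᵉ h) → ¬ u′ ∈ᵉ h →
               h ≢ e → h ≢ e′ → multiplicity h ≡ 0
      simple {h} j j′ u∈h u′∉h h≢e h≢e′ = when-false (multiple? h) λ m →
        case multiple⇒parallel m (joins-other u∈h) of λ
          { (f , f≢h , uf) → case Star.only (star (proj₁ (proj₂ j)) (proj₁ (proj₂ j′)) u∈h e≢e′ (h≢e ∘ sym) (h≢e′ ∘ sym)) f (proj₁ (proj₂ uf)) of λ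
            { (inj₁ refl) → u′∉h (subst (_∈ᵉ h) (joins-unique uf j) (proj₂ (proj₂ (joins-other u∈h))))
            ; (inj₂ (inj₁ refl)) → u′∉h (subst (_∈ᵉ h) (joins-unique uf j′) (proj₂ (proj₂ (joins-other u∈h))))
            ; (inj₂ (inj₂ f≡h)) → f≢h f≡h } }

      e-multiple : multiplicity e ≡ 3
      e-multiple = when-true (multiple? e) (parallel⇒multiple joins joins′ (e≢e′ ∘ sym))
      e′-multiple : multiplicity e′ ≡ 3
      e′-multiple = when-true (multiple? e′) (parallel⇒multiple joins′ joins e≢e′)
      h-simple : multiplicity h ≡ 0
      h-simple = simple joins joins′ u∈h (λ a → mu′ h a p) (apart C blank p ∘ sym) (apart C blank′ p ∘ sym)
      h′-simple : multiplicity h′ ≡ 0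
      h′-simple = simple (joins-sym joins) (joins-sym joins′) u′∈h′ (λ a → mu h′ a p′)
        (apart C blank p′ ∘ sym) (apart C blank′ p′ ∘ sym)

      heavier : weight multiplicity P₄.colouring ≡ weight multiplicity C + 6
      heavier = trans (sym (ℕ.+-identityʳ _)) (trans
        (cong (weight multiplicity P₄.colouring +_) (sym (cong₂ _+_ h-simple h′-simple)))
        (trans (tally multiplicity) (cong (weight multiplicity C +_) (cong₂ _+_ e-multiple e′-multiple))))

      keep : ∀ {v} → v ≢ other u h → v ≢ other u′ h′ → Social C v → Social P₄.colouring v
      keep {v} v≢x v≢y (j , f , v∈f , q) with v ≟ u | v ≟ u′
      ... | yes refl | _ = not k , e′ , u∈e′ , P₄.at
      ... | no _ | yes refl = not k , e′ , u′∈e′ , P₄.at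
      ... | no v≢u | no v≢u′ = j , P₄.sees blank₄ (P₃.sees (blank₂ blank) (f , v∈f ,
        trans (E₂.off λ { refl → [ v≢u′ , v≢y ]′ (joins-only (joins-other u′∈h′) v∈f) })
          (trans (E₁.off λ { refl → [ v≢u , v≢x ]′ (joins-only (joins-other u∈h) v∈f) }) q)))

      better : merit C < merit P₄.colouring
      better = begin-strict
        weight multiplicity C + sociality C                     ≤⟨ ℕ.+-monoʳ-≤ _ (sociality-loss C P₄.colouring _ _ keep) ⟩
        weight multiplicity C + (sociality P₄.colouring + 2)    <⟨ ℕ.m<m+n _ {4} (s≤s z≤n) ⟩
        weight multiplicity C + (sociality P₄.colouring + 2) + 4 ≡⟨ shuffle (weight multiplicity C) _ ⟩
        weight multiplicity C + 6 + sociality P₄.colouring      ≡⟨ cong (_+ sociality P₄.colouring) heavier ⟨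
        merit P₄.colouring                                      ∎
        where
        open ℕ.≤-Reasoning
        shuffle : ∀ a b → a + (b + 2) + 4 ≡ a + 6 + b
        shuffle = solve-∀

    -- The vertex `x` sees the second colour on some edge `q`, or else `h′` could be coloured.
    -- Trading `q` for `h′` keeps the size and gains a parallel edge, worth 3, while only the far
    -- end of `q` can become isolated.
    no-half-double : ∀ {h h′ u x k} → Deficient C u → Joins h u x → hue C h ≡ just k →
                     Joins h′ u x → hue C h′ ≢ nothing
    no-half-double {h} {h′} {u} {x} {k} (j , mj) ux p ux′ blank = case sees? C x (not k) of λ
        { (no ¬s) → no-common C max ux′ blank mu λ e a q → ¬s (e , a , q)
        ; (yes (q , x∈q , r)) → impossible q x∈q r }
      where
      u∈h = proj₁ (proj₂ ux)
      x∈h = proj₂ (proj₂ ux)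
      x∈h′ = proj₂ (proj₂ ux′)
      mu : Misses C u (not k)
      mu = subst (Misses C u) (¬-not λ { refl → mj h u∈h p }) mj
      impossible : ∀ q → x ∈ᵉ q → hue C q ≡ just (not k) → ⊥
      impossible q x∈q r = ℕ.<⇒≱ better (best P.colouring same)
        where
        h≢q : h ≢ q
        h≢q = differ C p r
        h′≢h : h′ ≢ h
        h′≢h = apart C blank p
        module E₁ = Erase C q
        blank₁ : hue E₁.colouring h′ ≡ nothing
        blank₁ = trans (E₁.off (apart C blank r)) blank
        module P = Paint E₁.colouring h′ (not k) ux′ (E₁.misses mu) (E₁.frees r x∈q)
        tally : ∀ w → weight w P.colouring + w q ≡ weight w C + w h′
        tally w = trans (cong (_+ w q) (P.weight-paint w blank₁)) (trans (shuffle _ (w h′) (w q))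
          (cong (_+ w h′) (E₁.weight-erase w r)))
          where
          shuffle : ∀ a b c → a + b + c ≡ a + c + b
          shuffle = solve-∀
        same : size P.colouring ≡ size C
        same = ℕ.+-cancelʳ-≡ 1 (size P.colouring) (size C) (tally (const 1))
        q-simple : multiplicity q ≡ 0
        q-simple = when-false (multiple? q) λ m → case multiple⇒parallel m (joins-other x∈q) of λ
          { (f , f≢q , xf) → case Star.only (star x∈h x∈h′ x∈q (h′≢h ∘ sym) h≢q (apart C blank r)) f (proj₁ (proj₂ xf)) of λ
            { (inj₁ refl) → mu q (subst (_∈ᵉ q) (joins-unique xf (joins-sym ux)) (proj₂ (proj₂ (joins-other x∈q)))) r
            ; (inj₂ (inj₁ refl)) → mu q (subst (_∈ᵉ q) (joins-unique xf (joins-sym ux′)) (proj₂ (proj₂ (joins-other x∈q)))) r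
            ; (inj₂ (inj₂ f≡q)) → f≢q f≡q } }
        h′-multiple : multiplicity h′ ≡ 3
        h′-multiple = when-true (multiple? h′) (parallel⇒multiple ux′ ux (h′≢h ∘ sym))
        heavier : weight multiplicity P.colouring ≡ weight multiplicity C + 3
        heavier = trans (sym (ℕ.+-identityʳ _)) (trans
          (cong (weight multiplicity P.colouring +_) (sym q-simple))
          (trans (tally multiplicity) (cong (weight multiplicity C +_) h′-multiple)))
        keep : ∀ {v} → v ≢ other x q → v ≢ other x q → Social C v → Social P.colouring v
        keep {v} v≢p _ (j , f , v∈f , s) with v ≟ x
        ... | yes refl = not k , h′ , x∈h′ , P.at
        ... | no v≢x = j , P.sees blank₁ (f , v∈f ,
          trans (E₁.off λ { refl → [ v≢x , v≢p ]′ (joins-only (joins-other x∈q) v∈f) }) s)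
        better : merit C < merit P.colouring
        better = begin-strict
          weight multiplicity C + sociality C                      ≤⟨ ℕ.+-monoʳ-≤ _ (sociality-loss C P.colouring _ _ keep) ⟩
          weight multiplicity C + (sociality P.colouring + 2)      <⟨ ℕ.m<m+n _ {1} (s≤s z≤n) ⟩
          weight multiplicity C + (sociality P.colouring + 2) + 1  ≡⟨ shuffle (weight multiplicity C) _ ⟩
          weight multiplicity C + 3 + sociality P.colouring        ≡⟨ cong (_+ sociality P.colouring) heavier ⟨
          merit P.colouring                                        ∎
          where
          open ℕ.≤-Reasoning
          shuffle : ∀ a b → a + (b + 2) + 1 ≡ a + 3 + b
          shuffle = solve-∀

    -- Otherwise `g` could take over the colour of `e`: then `v` is no longer isolated, `a` keeps
    -- its edge of the other colour, and no multiplicity is lost because `e` is simple.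
    isolated-reach : ∀ {v g z e a k} → Isolated C v → Joins g v z → hue C g ≡ nothing →
                     Joins e z a → hue C e ≡ just k → ¬ Multiple e → Deficient C a
    isolated-reach {v} {g} {z} {e} {a} {k} iso vz blank za p simple with deficient? C a
    ... | yes d = d
    ... | no ¬d = contradiction (best P.colouring same) (ℕ.<⇒≱ better)
      where
      z∈e = proj₁ (proj₂ za)
      v∈g = proj₁ (proj₂ vz)
      z∈g = proj₂ (proj₂ vz)
      module E₁ = Erase C e
      blank₁ : hue E₁.colouring g ≡ nothing
      blank₁ = trans (E₁.off (apart C blank p)) blank
      module P = Paint E₁.colouring g k vz (E₁.misses (iso k)) (E₁.frees p z∈e)
      tally : ∀ w → weight w P.colouring + w e ≡ weight w C + w g
      tally w = trans (cong (_+ w e) (P.weight-paint w blank₁)) (trans (shuffle _ (w g) (w e))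
        (cong (_+ w g) (E₁.weight-erase w p)))
        where
        shuffle : ∀ a b c → a + b + c ≡ a + c + b
        shuffle = solve-∀
      same : size P.colouring ≡ size C
      same = ℕ.+-cancelʳ-≡ 1 (size P.colouring) (size C) (tally (const 1))
      keep : ∀ {w} → Social C w → Social P.colouring w
      keep {w} (j , f , w∈f , q) with w ≟ z | w ≟ a
      ... | yes refl | _ = k , g , z∈g , P.at
      ... | no w≢z | yes refl with ¬misses⇒sees C (λ m → ¬d (not k , m))
      ...   | f′ , w∈f′ , q′ = not k , P.sees blank₁ (f′ , w∈f′ , trans (E₁.off (differ C p q′ ∘ sym)) q′)
      keep {w} (j , f , w∈f , q) | no w≢z | no w≢a = j , P.sees blank₁ (f , w∈f ,
        trans (E₁.off λ { refl → [ w≢z , w≢a ]′ (joins-only za w∈f) }) q)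
      better : merit C < merit P.colouring
      better = begin-strict
        weight multiplicity C + sociality C              ≤⟨ ℕ.+-monoˡ-≤ (sociality C) (ℕ.m≤m+n (weight multiplicity C) (multiplicity g)) ⟩
        weight multiplicity C + multiplicity g + sociality C ≡⟨ cong (_+ sociality C) (tally multiplicity) ⟨
        weight multiplicity P.colouring + multiplicity e + sociality C ≡⟨ cong (λ m → weight multiplicity P.colouring + m + sociality C) (when-false (multiple? e) simple) ⟩
        weight multiplicity P.colouring + 0 + sociality C ≡⟨ cong (_+ sociality C) (ℕ.+-identityʳ _) ⟩
        weight multiplicity P.colouring + sociality C    <⟨ ℕ.+-monoʳ-< (weight multiplicity P.colouring) (subst (_≤ sociality P.colouring) (ℕ.+-comm _ 1) (sociality-gain C P.colouring (λ s → social⇒¬isolated C s iso) (k , g , v∈g , P.at) keep)) ⟩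
        merit P.colouring                                ∎
        where open ℕ.≤-Reasoning

    -- One edge of a coloured digon z a may be replaced by the two edges leaving it.
    digon-reach : ∀ {v g z a g′ w} → Isolated C v → Joins g v z → hue C g ≡ nothing →
                  (∀ k → ∃ λ e → Joins e z a × hue C e ≡ just k) →
                  Joins g′ a w → hue C g′ ≡ nothing → w ≢ v → w ≢ z → ¬ Deficient C w
    digon-reach {v} {g} {z} {a} {g′} {w} iso vz blank digon aw blank′ w≢v w≢z (k , mw)
      -- The digon edge is taken in the colour that `w` misses, so that both `g` and `g′` can
      -- inherit it.
      with e , za , p ← digon k = ℕ.1+n≰n (subst (_≤ size C) grown (max P₂.colouring))
      where
      z∈e = proj₁ (proj₂ za)
      a∈e = proj₂ (proj₂ za)
      a≢v : a ≢ v
      a≢v refl = iso k e a∈e p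
      module E₁ = Erase C e
      module P₁ = Paint E₁.colouring g k vz (E₁.misses (iso k)) (E₁.frees p z∈e)
      a∉g : ¬ a ∈ᵉ g
      a∉g a∈g = [ a≢v , proj₁ za ∘ sym ]′ (joins-only vz a∈g)
      module P₂ = Paint P₁.colouring g′ k aw
        (P₁.misses-away a∉g (E₁.frees p a∈e))
        (P₁.misses-away (λ w∈g → [ w≢v , w≢z ]′ (joins-only vz w∈g)) (E₁.misses mw))
      g′≢g : g′ ≢ g
      g′≢g refl = a∉g (proj₁ (proj₂ aw))
      grown : size P₂.colouring ≡ 1 + size C
      grown = begin
        size P₂.colouring        ≡⟨ P₂.weight-paint (const 1) (trans (P₁.off g′≢g) (trans (E₁.off (apart C blank′ p)) blank′)) ⟩
        size P₁.colouring + 1    ≡⟨ cong (_+ 1) (P₁.weight-paint (const 1) (trans (E₁.off (apart C blank p)) blank)) ⟩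
        size E₁.colouring + 1 + 1 ≡⟨ cong (_+ 1) (E₁.weight-erase (const 1) p) ⟩
        size C + 1               ≡⟨ ℕ.+-comm _ 1 ⟩
        1 + size C               ∎
        where open ≡-Reasoning

  -- Units relayed along coloured edges

  module Discharging (C : Colouring) (optimal : Optimal C) where
    open Optimal optimal
    open Optimality C optimal

    blank? : ∀ e → Dec (hue C e ≡ nothing)
    blank? e = Maybe.≡-dec Bool._≟_ (hue C e) nothing

    Exposed Lonely : V → Set
    Exposed v = ∃ λ f → v ∈ᵉ f × hue C f ≡ nothing × Deficient C (other v f)
    Lonely v = ∃ λ f → v ∈ᵉ f × hue C f ≡ nothing × Isolated C (other v f)

    opaque
      exposed? : ∀ v → Dec (Exposed v)
      exposed? v = any? λ f → v ∈ᵉ? f ×-dec blank? f ×-dec deficient? C (other v f)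

    opaque
      lonely? : ∀ v → Dec (Lonely v)
      lonely? v = any? λ f → v ∈ᵉ? f ×-dec blank? f ×-dec isolated? C (other v f)

    lonely⇒exposed : ∀ {v} → Lonely v → Exposed v
    lonely⇒exposed (f , v∈f , p , iso) = f , v∈f , p , true , iso true

    -- What v sends along its coloured edge e: one unit if no uncoloured edge
    -- joins v to a deficient vertex, and otherwise whatever v receives along its
    -- other coloured edge, unless v keeps that for an isolated neighbour.
    opaque
      relay : ℕ → V → E → ℕ
      relay zero    v e = 0
      relay (suc n) v e =
        if does (exposed? v)
        then (if does (lonely? v) then 0
              else sumAt v λ f → when (¬? (f ≟ e)) (shade (hue C f) (relay n (other v f) f)))
        else 1

    forward : ℕ → V → E → ℕ
    forward n v e = sumAt v λ f → when (¬? (f ≟ e)) (shade (hue C f) (relay n (other v f) f))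

    opaque
      unfolding relay

      relay-lonely : ∀ n {v e} → Lonely v → relay n v e ≡ 0
      relay-lonely zero    l = refl
      relay-lonely (suc n) {v} {e} l = trans
        (cong (λ b → if b then (if does (lonely? v) then 0 else forward n v e) else 1) (dec-true (exposed? v) (lonely⇒exposed l)))
        (cong (λ b → if b then 0 else forward n v e) (dec-true (lonely? v) l))

    opaque
      unfolding relay

      relay-exposed : ∀ n {v e} → Exposed v → ¬ Lonely v → relay (suc n) v e ≡ forward n v e
      relay-exposed n {v} {e} ex ¬l = trans
        (cong (λ b → if b then (if does (lonely? v) then 0 else forward n v e) else 1) (dec-true (exposed? v) ex))
        (cong (λ b → if b then 0 else forward n v e) (dec-false (lonely? v) ¬l))

    opaque
      unfolding relay

      relay-sheltered : ∀ n {v e} → ¬ Exposed v → relay (suc n) v e ≡ 1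
      relay-sheltered n {v} {e} ¬ex =
        cong (λ b → if b then (if does (lonely? v) then 0 else forward n v e) else 1) (dec-false (exposed? v) ¬ex)

    shade-mono : ∀ h {x y} → x ≤ y → shade h x ≤ shade h y
    shade-mono (just _) x≤y = x≤y
    shade-mono nothing  x≤y = z≤n

    opaque
      unfolding relay

      -- The argument `n` is fuel, since relaying could otherwise run around a two-coloured cycle. A
      -- vertex passes on amounts computed with less fuel than the amounts it receives, and
      -- monotonicity makes these affordable.
      relay-mono : ∀ n v e → relay n v e ≤ relay (suc n) v e
      relay-mono zero    v e = z≤n
      relay-mono (suc n) v e with does (exposed? v) | does (lonely? v)
      ... | false | _     = ℕ.≤-refl
      ... | true  | true  = ℕ.≤-refl
      ... | true  | false = sum-mono λ f → when-mono (v ∈ᵉ? f) (when-mono (¬? (f ≟ e))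
        (shade-mono (hue C f) (relay-mono n (other v f) f)))

    relay-passes : ∀ n {v e x f k} → Exposed v → ¬ Lonely v → Joins f x v → f ≢ e → hue C f ≡ just k →
                   relay n x f ≤ relay (suc n) v e
    relay-passes n {v} {e} {x} {f} ex ¬l xv f≢e p = begin
      relay n x f          ≡⟨ cong (λ w → relay n w f) (joins⇒other (joins-sym xv)) ⟨
      relay n (other v f) f ≡⟨ cong (λ h → shade h (relay n (other v f) f)) p ⟨
      shade (hue C f) (relay n (other v f) f) ≡⟨ when-true (¬? (f ≟ e)) f≢e ⟨
      when (¬? (f ≟ e)) (shade (hue C f) (relay n (other v f) f)) ≡⟨ when-true (v ∈ᵉ? f) (proj₂ (proj₂ xv)) ⟨
      summand f            ≤⟨ term≤sum summand f ⟩
      forward n v e        ≡⟨ relay-exposed n ex ¬l ⟨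
      relay (suc n) v e    ∎
      where
      open ℕ.≤-Reasoning
      summand : E → ℕ
      summand f = when (v ∈ᵉ? f) (when (¬? (f ≟ e)) (shade (hue C f) (relay n (other v f) f)))

    -- Along the path that ends in u, the first vertex x, or if x is joined to u′
    -- the second vertex p, or if p is joined to u the third vertex r has a unit to
    -- spare: the edges x u′ and p u use up the degrees of u and u′.
    module GapReceives {e u u′} (o : OpenEdge C e u u′) (R₁ : Rotation C e u u′)
      (R₂ : Rotation (Rotation.next R₁) (Rotation.h R₁) (Rotation.x R₁) u)
      (R₃ : Rotation (Rotation.next R₂) (Rotation.h R₂) (Rotation.x R₂) (Rotation.x R₁)) where

      module R₁ = Rotation R₁
      module R₂ = Rotation R₂
      module R₃ = Rotation R₃
      open OpenEdge o
      open R₁ using (k; h; x)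
      open Polar R₁.polarity
      p r : V
      p = R₂.x
      r = R₃.x
      hp hr h′ : E
      hp = R₂.h
      hr = R₃.h
      h′ = proj₁ sees₂

      u∈e = proj₁ (proj₂ joins)
      u′∈e = proj₂ (proj₂ joins)
      x∈h = proj₁ (proj₂ R₁.h-joins)
      u∈h = proj₂ (proj₂ R₁.h-joins)
      p∈hp = proj₁ (proj₂ R₂.h-joins)
      x∈hp = proj₂ (proj₂ R₂.h-joins)
      r∈hr = proj₁ (proj₂ R₃.h-joins)
      p∈hr = proj₂ (proj₂ R₃.h-joins)
      u′∈h′ = proj₁ (proj₂ sees₂)

      x∉e : ¬ x ∈ᵉ e
      x∉e x∈e = [ proj₁ R₁.h-joins , R₁.x≢u′ ]′ (joins-only joins x∈e)

      hue-hp : hue C hp ≡ just R₂.k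
      hue-hp = trans (sym (R₁.next-off (λ hp≡e → x∉e (subst (x ∈ᵉ_) hp≡e x∈hp)) (apart R₁.next R₁.next-h R₂.h-hue ∘ sym))) R₂.h-hue

      hp≢h : hp ≢ h
      hp≢h = apart R₁.next R₁.next-h R₂.h-hue ∘ sym

      u-social : Social C u
      u-social = k , sees₁
      u′-social : Social C u′
      u′-social = not k , sees₂

      free : ∀ {v f} → v ≢ u → v ≢ u′ → v ∈ᵉ f → f ≢ e
      free v≢u v≢u′ v∈f refl = [ v≢u , v≢u′ ]′ (joins-only joins v∈f)

      x-sated : ¬ Deficient C x
      x-sated (j , m) = sees-misses C (R₁.x-sees j) m

      sheltered : ∀ n {v f} → ¬ Exposed v → 1 ≤ relay (suc n) v f
      sheltered n ¬ex = ℕ.≤-reflexive (sym (relay-sheltered n ¬ex))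

      module _ {g : E} (g-blank : hue C g ≡ nothing) (xu′ : Joins g x u′) where

        x∈g = proj₁ (proj₂ xu′)
        u′∈g = proj₂ (proj₂ xu′)

        p≢u : p ≢ u
        p≢u = R₂.x≢u′

        p≢x : p ≢ x
        p≢x = proj₁ R₂.h-joins

        p≢u′ : p ≢ u′
        p≢u′ p≡u′ = no-half-double def₂ (subst (λ w → Joins hp w x) p≡u′ R₂.h-joins) hue-hp (joins-sym xu′) g-blank

        p∉h : ¬ p ∈ᵉ h
        p∉h p∈h = [ p≢x , p≢u ]′ (joins-only R₁.h-joins p∈h)

        p-sated : ¬ Deficient C p
        p-sated (j , m) with f , p∈f , q ← R₂.x-sees j =
          m f p∈f (trans (sym (R₁.next-off (free p≢u p≢u′ p∈f) λ { refl → p∉h p∈f })) q)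

        u′-star : Star u′ e g h′
        u′-star = star u′∈e u′∈g u′∈h′ (λ { refl → x∉e x∈g })
          (apart C blank (proj₂ (proj₂ sees₂))) (apart C g-blank (proj₂ (proj₂ sees₂)))

        -- Deficiency may fail to survive the first slide only at `u′`. As `e`, `g` and `h′` use up
        -- the degree of `u′`, no uncoloured edge from a later path vertex ends there.
        u′-far : ∀ {w f} → w ≢ u → w ≢ u′ → w ≢ x → w ∈ᵉ f → hue C f ≡ nothing → ¬ u′ ∈ᵉ f
        u′-far w≢u w≢u′ w≢x w∈f q u′∈f with Star.only u′-star _ u′∈f
        ... | inj₁ refl = free w≢u w≢u′ w∈f refl
        ... | inj₂ (inj₁ refl) = [ w≢x , w≢u′ ]′ (joins-only xu′ w∈f)
        ... | inj₂ (inj₂ refl) = apart C q (proj₂ (proj₂ sees₂)) refl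

        -- The second slide starts from a gap between `x` and `u`, so these are the only candidates,
        -- and `x` sees both colours in `C`.
        p-neighbour : ∀ {f} → p ∈ᵉ f → hue C f ≡ nothing → Deficient C (other p f) → other p f ≡ u
        p-neighbour {f} p∈f q dw with R₂.confined (joins-other p∈f)
          (trans (R₁.next-off (free p≢u p≢u′ p∈f) (apart C q R₁.h-hue)) q)
          (R₁.persists (λ w≡u′ → u′-far p≢u p≢u′ p≢x p∈f q (subst (_∈ᵉ f) w≡u′ (proj₂ (proj₂ (joins-other p∈f))))) dw)
        ... | inj₁ w≡x = contradiction (subst (Deficient C) w≡x dw) x-sated
        ... | inj₂ w≡u = w≡u

        module _ {f : E} (f-blank : hue C f ≡ nothing) (pu : Joins f p u) where

          hr≢hp : hr ≢ hp
          hr≢hp = apart R₂.next R₂.next-h R₃.h-hue ∘ sym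

          hr≢h : hr ≢ h
          hr≢h hr≡h = p∉h (subst (p ∈ᵉ_) hr≡h p∈hr)

          hue-hr : hue C hr ≡ just R₃.k
          hue-hr = trans (sym (trans (R₂.next-off hr≢h hr≢hp) (R₁.next-off (free p≢u p≢u′ p∈hr) hr≢h))) R₃.h-hue

          R₂k≢k : R₂.k ≢ k
          R₂k≢k eq = hp≢h (proper C x∈hp x∈h hue-hp (trans R₁.h-hue (cong just (sym eq))))

          -- Colours alternate along the path, so `hr` has the colour of `h`. This separates `r`
          -- from `u`, whose edge of that colour is `h`, and from `u′`, which misses the colour.
          R₃k≡k : R₃.k ≡ k
          R₃k≡k with R₃.k Bool.≟ R₂.k
          ... | yes eq = contradiction (proper C p∈hr p∈hp hue-hr (trans hue-hp (cong just (sym eq)))) hr≢hp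
          ... | no ne = trans (¬-not ne) (sym (¬-not (R₂k≢k ∘ sym)))

          hue-hr′ : hue C hr ≡ just k
          hue-hr′ = trans hue-hr (cong just R₃k≡k)

          r≢u : r ≢ u
          r≢u r≡u = hr≢h (proper C (subst (_∈ᵉ hr) r≡u r∈hr) u∈h hue-hr′ R₁.h-hue)

          r≢u′ : r ≢ u′
          r≢u′ r≡u′ = misses₂ hr (subst (_∈ᵉ hr) r≡u′ r∈hr) hue-hr′

          r≢p : r ≢ p
          r≢p = proj₁ R₃.h-joins

          u-star : Star u h e f
          u-star = star u∈h u∈e (proj₂ (proj₂ pu)) (apart C blank R₁.h-hue ∘ sym)
            (apart C f-blank R₁.h-hue ∘ sym) (free p≢u p≢u′ (proj₁ (proj₂ pu)) ∘ sym)

          u-far : ∀ {f′} → r ∈ᵉ f′ → hue C f′ ≡ nothing → ¬ u ∈ᵉ f′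
          u-far r∈f′ q u∈f′ with Star.only u-star _ u∈f′
          ... | inj₁ refl = apart C q R₁.h-hue refl
          ... | inj₂ (inj₁ refl) = free r≢u r≢u′ r∈f′ refl
          ... | inj₂ (inj₂ refl) = [ r≢p , r≢u ]′ (joins-only pu r∈f′)

          -- The third slide leaves only `p` and `x` as deficient neighbours across an uncoloured
          -- edge, and both are sated in `C`.
          r-sheltered : ¬ Exposed r
          r-sheltered (f′ , r∈f′ , q , dw) with R₃.confined rw
            (trans (R₂.next-off (apart C q R₁.h-hue) (apart C q hue-hp))
              (trans (R₁.next-off (free r≢u r≢u′ r∈f′) (apart C q R₁.h-hue)) q))
            (R₂.persists (λ w≡u → u-far r∈f′ q (subst (_∈ᵉ f′) w≡u w∈f′))
              (R₁.persists (λ w≡u′ → u′-far r≢u r≢u′ R₃.x≢u′ r∈f′ q (subst (_∈ᵉ f′) w≡u′ w∈f′)) dw))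
            where
            rw : Joins f′ r (other r f′)
            rw = joins-other r∈f′
            w∈f′ : other r f′ ∈ᵉ f′
            w∈f′ = proj₂ (proj₂ rw)
          ... | inj₁ w≡p = p-sated (subst (Deficient C) w≡p dw)
          ... | inj₂ w≡x = x-sated (subst (Deficient C) w≡x dw)

        at-p : 1 ≤ relay 2 p hp
        at-p = case exposed? p of λ
          { (no ¬ex) → sheltered 1 ¬ex
          ; (yes ex@(f , p∈f , q , dw)) → ℕ.≤-trans
              (sheltered 0 (r-sheltered q (subst (Joins f p) (p-neighbour p∈f q dw) (joins-other p∈f))))
              (relay-passes 1 ex ¬lonely R₃.h-joins
                (apart R₂.next R₂.next-h R₃.h-hue ∘ sym)
                (hue-hr q (subst (Joins f p) (p-neighbour p∈f q dw) (joins-other p∈f)))) }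
          where
          ¬lonely : ¬ Lonely p
          ¬lonely (f , p∈f , q , iso) = social⇒¬isolated C u-social
            (subst (Isolated C) (p-neighbour p∈f q (true , iso true)) iso)

      at-x : 1 ≤ relay 3 x h
      at-x = case exposed? x of λ
        { (no ¬ex) → sheltered 2 ¬ex
        ; (yes ex@(g , x∈g , q , dw)) → ℕ.≤-trans
            (at-p q (subst (Joins g x) (x-neighbour x∈g q dw) (joins-other x∈g)))
            (relay-passes 2 ex ¬lonely R₂.h-joins hp≢h hue-hp) }
        where
        x-neighbour : ∀ {g} → x ∈ᵉ g → hue C g ≡ nothing → Deficient C (other x g) → other x g ≡ u′
        x-neighbour {g} x∈g q dw with R₁.confined (joins-other x∈g) q dw
        ... | inj₂ w≡u′ = w≡u′
        -- An uncoloured edge from `x` back to `u` would be parallel to the coloured edge `h`.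
        ... | inj₁ w≡u = contradiction q (no-half-double def₁ (joins-sym R₁.h-joins) R₁.h-hue
          (joins-sym (subst (Joins g x) w≡u (joins-other x∈g))))
        ¬lonely : ¬ Lonely x
        ¬lonely (f , x∈f , q , iso) = social⇒¬isolated C u′-social
          (subst (Isolated C) (x-neighbour x∈f q (true , iso true)) iso)

    -- The unit may have to travel from `r` through `p` and `x`; these three relays determine the
    -- fuel 3.
    gap-receives : ∀ {e u u′} → OpenEdge C e u u′ → (R : Rotation C e u u′) →
                   1 ≤ relay 3 (Rotation.x R) (Rotation.h R)
    gap-receives o R₁ = GapReceives.at-x o R₁ R₂ (rotate _ (Rotation.next-max R₂) (Rotation.next-open R₂))
      where
      R₂ : Rotation (Rotation.next R₁) (Rotation.h R₁) (Rotation.x R₁) _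
      R₂ = rotate _ (Rotation.next-max R₁) (Rotation.next-open R₁)

    -- z and a stand for the ends of f and g other than v.
    record Twins (f g : E) (v : V) : Set where
      field
        v∈g   : v ∈ᵉ g
        blank : hue C g ≡ nothing
        f≢g   : f ≢ g
        via-z : ∀ {h k} → other v f ∈ᵉ h → hue C h ≡ just k → other (other v f) h ≡ other v g
        via-a : ∀ {h k} → other v g ∈ᵉ h → hue C h ≡ just k → other (other v g) h ≡ other v f

    -- Supplies for isolated vertices

    opaque
      income : V → ℕ
      income z = sumAt z λ f → shade (hue C f) (relay 3 (other z f) f)

    sated-star : ∀ {v} → ¬ Deficient C v → ∃ λ e₁ → ∃₂ λ e₂ g → Star v e₁ e₂ g ×
                 hue C e₁ ≡ just true × hue C e₂ ≡ just false × hue C g ≡ nothing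
    sated-star {v} ¬d
      with e₁ , a₁ , p₁ ← ¬misses⇒sees C {v} {true} (λ m → ¬d (true , m))
      with e₂ , a₂ , p₂ ← ¬misses⇒sees C {v} {false} (λ m → ¬d (false , m))
      with g , s ← star₂ a₁ a₂ (differ C p₁ p₂) = e₁ , e₂ , g , s , p₁ , p₂ , g-blank (hue C g) refl
      where
      g-blank : ∀ h → hue C g ≡ h → h ≡ nothing
      g-blank nothing      q = refl
      g-blank (just true)  q = contradiction (proper C a₁ (Star.at₃ s) p₁ q) (Star.≢₁₃ s)
      g-blank (just false) q = contradiction (proper C a₂ (Star.at₃ s) p₂ q) (Star.≢₂₃ s)

    social-near-isolated : ∀ {v f} → Isolated C v → v ∈ᵉ f → hue C f ≡ nothing → ¬ Deficient C (other v f)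
    social-near-isolated iso v∈f q (k , m) = no-common C max (joins-other v∈f) q (iso k) m


    opaque
      unfolding income

      income-star : ∀ {z e₁ e₂ g j k} → Star z e₁ e₂ g → hue C e₁ ≡ just j → hue C e₂ ≡ just k → hue C g ≡ nothing →
                    income z ≡ relay 3 (other z e₁) e₁ + relay 3 (other z e₂) e₂
      income-star {z} {e₁} {e₂} {g} s p₁ p₂ q = trans (sumAt-star inflow s)
        (trans (cong₂ _+_ (coloured p₁) (cong₂ _+_ (coloured p₂) blank)) (cong (relay 3 (other z e₁) e₁ +_) (ℕ.+-identityʳ _)))
        where
        inflow : E → ℕ
        inflow f = shade (hue C f) (relay 3 (other z f) f)
        coloured : ∀ {e k} → hue C e ≡ just k → inflow e ≡ relay 3 (other z e) e
        coloured {e} p = cong (λ h → shade h (relay 3 (other z e) e)) p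
        blank : inflow g ≡ 0
        blank = cong (λ h → shade h (relay 3 (other z g) g)) q

    same-blank : ∀ {z f g} → ¬ Deficient C z → z ∈ᵉ f → z ∈ᵉ g → hue C f ≡ nothing → hue C g ≡ nothing → f ≡ g
    same-blank {z} {f} {g} ¬d z∈f z∈g q r with sated-star ¬d
    ... | _ , _ , _ , s , p₁ , p₂ , _ = trans (third z∈f q) (sym (third z∈g r))
      where
      third : ∀ {f} → z ∈ᵉ f → hue C f ≡ nothing → f ≡ _
      third z∈f q with Star.only s _ z∈f
      ... | inj₁ refl = contradiction refl (apart C q p₁)
      ... | inj₂ (inj₁ refl) = contradiction refl (apart C q p₂)
      ... | inj₂ (inj₂ f≡) = f≡

    -- The edge `f` leads to `v`, which meets no coloured edge, so among the three edges at the
    -- neighbour only `e₂` can be parallel to `e₁`.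
    digon-mate : ∀ {v f e₁ e₂ j k} → Isolated C v → v ∈ᵉ f → hue C f ≡ nothing →
            Star (other v f) e₁ e₂ f → hue C e₁ ≡ just j → hue C e₂ ≡ just k → Multiple e₁ →
            Joins e₂ (other v f) (other (other v f) e₁)
    digon-mate {v} {f} {e₁} {e₂} iso v∈f q s p₁ p₂ m
      with multiple⇒parallel m (joins-other (Star.at₁ s))
    ... | e , e≢e₁ , za with Star.only s e (proj₁ (proj₂ za))
    ...   | inj₁ e≡e₁ = contradiction e≡e₁ e≢e₁
    ...   | inj₂ (inj₁ refl) = za
    ...   | inj₂ (inj₂ refl) with joins-only (joins-other v∈f) (proj₂ (proj₂ za))
    ...     | inj₂ a≡z = contradiction (sym a≡z) (proj₁ za)
    ...     | inj₁ a≡v = contradiction p₁ (iso _ _ (subst (_∈ᵉ e₁) a≡v (proj₂ (proj₂ (joins-other (Star.at₁ s))))))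

    -- If the far vertex of the digon is not exposed, it sends a unit along each of the two digon
    -- edges. Otherwise its uncoloured edge leads to a deficient vertex, which `digon-reach` forces
    -- to be `v`.
    digon-income : ∀ {v f e₁ e₂ j} → Isolated C v → v ∈ᵉ f → hue C f ≡ nothing →
                   Star (other v f) e₁ e₂ f → hue C e₁ ≡ just j → hue C e₂ ≡ just (not j) →
                   Multiple e₁ → 2 ≤ income (other v f) ⊎ ∃ λ g → Twins f g v
    digon-income {v} {f} {e₁} {e₂} {j} iso v∈f q s p₁ p₂ m = conclude
      where
      z a : V
      z = other v f
      a = other z e₁
      za₁ : Joins e₁ z a
      za₁ = joins-other (Star.at₁ s)
      za₂ : Joins e₂ z a
      za₂ = digon-mate iso v∈f q s p₁ p₂ m
      a∈e₁ = proj₂ (proj₂ za₁)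
      a∈e₂ = proj₂ (proj₂ za₂)
      both : ∀ k → ∃ λ e → Joins e z a × hue C e ≡ just k
      both k with k Bool.≟ j
      ... | yes refl = e₁ , za₁ , p₁
      ... | no k≢j = e₂ , za₂ , trans p₂ (cong just (sym (¬-not k≢j)))
      only-digon : ∀ {w h k} → (w∈h : w ∈ᵉ h) → w ∈ᵉ e₁ → w ∈ᵉ e₂ → hue C h ≡ just k → h ≡ e₁ ⊎ h ≡ e₂
      only-digon {k = k} w∈h w∈e₁ w∈e₂ p with k Bool.≟ j
      ... | yes refl = inj₁ (proper C w∈h w∈e₁ p p₁)
      ... | no k≢j = inj₂ (proper C w∈h w∈e₂ p (trans p₂ (cong just (sym (¬-not k≢j)))))
      z∈f : z ∈ᵉ f
      z∈f = proj₂ (proj₂ (joins-other v∈f))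
      a∉f : ¬ a ∈ᵉ f
      a∉f a∈f with joins-only (joins-other v∈f) a∈f
      ... | inj₁ a≡v = iso _ _ (subst (_∈ᵉ e₁) a≡v a∈e₁) p₁
      ... | inj₂ a≡z = proj₁ za₁ (sym a≡z)
      conclude : 2 ≤ income z ⊎ ∃ λ g → Twins f g v
      conclude = case exposed? a of λ
        { (no ¬ex) → inj₁ (ℕ.≤-reflexive (sym (trans (income-star s p₁ p₂ q)
            (cong₂ _+_ (relay-sheltered 2 ¬ex)
              (trans (cong (λ w → relay 3 w e₂) (joins⇒other za₂)) (relay-sheltered 2 ¬ex))))))
        ; (yes (g , a∈g , r , d)) → inj₂ (g , twins g a∈g r d) }
        where
        twins : ∀ g → a ∈ᵉ g → hue C g ≡ nothing → Deficient C (other a g) → Twins f g v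
        twins g a∈g r d with other a g ≟ v
        ... | no w≢v = contradiction d (digon-reach iso (joins-other v∈f) q both (joins-other a∈g) r w≢v
          λ w≡z → a∉f (subst (a ∈ᵉ_) (same-blank (social-near-isolated iso v∈f q) (subst (_∈ᵉ g) w≡z (proj₂ (proj₂ (joins-other a∈g)))) z∈f r q) a∈g))
        ... | yes w≡v = record
          { v∈g = v∈g ; blank = r ; f≢g = λ { refl → a∉f a∈g }
          ; via-z = via-z
          ; via-a = λ {h} {k} a∈h p → subst (λ w → w ∈ᵉ h → other w h ≡ z) (sym ga) (via-a p) a∈h
          }
          where
          v∈g : v ∈ᵉ g
          v∈g = subst (_∈ᵉ g) w≡v (proj₂ (proj₂ (joins-other a∈g)))
          ga : other v g ≡ a
          ga = joins⇒other (joins-sym (subst (Joins g a) w≡v (joins-other a∈g)))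
          via-z : ∀ {h k} → z ∈ᵉ h → hue C h ≡ just k → other z h ≡ other v g
          via-z z∈h p with only-digon z∈h (Star.at₁ s) (Star.at₂ s) p
          ... | inj₁ refl = trans (joins⇒other za₁) (sym ga)
          ... | inj₂ refl = trans (joins⇒other za₂) (sym ga)
          via-a : ∀ {h k} → hue C h ≡ just k → a ∈ᵉ h → other a h ≡ z
          via-a p a∈h with only-digon a∈h a∈e₁ a∈e₂ p
          ... | inj₁ refl = joins⇒other (joins-sym za₁)
          ... | inj₂ refl = joins⇒other (joins-sym za₂)

    -- By `isolated-reach` the far end of `e` is a path end. If it had a gap, sliding that gap onto
    -- `e` would confine the deficient uncoloured neighbours of `other v f` to the two ends of the
    -- gap; these have coloured edges, but `v` has none.
    single-income : ∀ {v f e k} → Isolated C v → v ∈ᵉ f → hue C f ≡ nothing →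
                    other v f ∈ᵉ e → hue C e ≡ just k → ¬ Multiple e →
                    relay 3 (other (other v f) e) e ≡ 1
    single-income {v} {f} {e} {k} iso v∈f q z∈e p simple = relay-sheltered 2 sheltered
      where
      z a : V
      z = other v f
      a = other z e
      vz : Joins f v z
      vz = joins-other v∈f
      za : Joins e z a
      za = joins-other z∈e
      a∈e = proj₂ (proj₂ za)
      a-def : Deficient C a
      a-def = isolated-reach iso vz q za p simple
      refute : ∀ {g u′} → OpenEdge C g a u′ → Rotation C g a u′ → ⊥
      refute {g} {u′} o R = case confined zv q (true , iso true) of λ
        { (inj₁ v≡a) → iso k e (subst (_∈ᵉ e) (sym v≡a) a∈e) p
        ; (inj₂ v≡u′) → social⇒¬isolated C (_ , sees₂) (subst (Isolated C) v≡u′ iso) }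
        where
        open Rotation R renaming (k to j)
        open Polar polarity
        k≡j : k ≡ j
        k≡j with k Bool.≟ j
        ... | yes eq = eq
        ... | no ne = contradiction (trans p (cong just (¬-not ne))) (misses₁ e a∈e)
        e≡h : e ≡ h
        e≡h = proper C a∈e (proj₂ (proj₂ h-joins)) p (trans h-hue (cong just (sym k≡j)))
        z≡x : z ≡ x
        z≡x = joins-unique (joins-sym za) (subst (λ h → Joins h a x) (sym e≡h) (joins-sym h-joins))
        zv : Joins f x v
        zv = subst (λ w → Joins f w v) z≡x (joins-sym vz)
      sheltered : ¬ Exposed a
      sheltered (g , a∈g , r , d) = refute o (rotate C max o)
        where
        o : OpenEdge C g a (other a g)
        o = openEdge (joins-other a∈g) r a-def d

    isolated-edge : ∀ {v f} → Isolated C v → v ∈ᵉ f → hue C f ≡ nothing →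
                    2 ≤ income (other v f) ⊎ ∃ λ g → Twins f g v
    isolated-edge {v} {f} iso v∈f q with sated-star (social-near-isolated iso v∈f q)
    ... | e₁ , e₂ , g , s , p₁ , p₂ , r
      with refl ← same-blank (social-near-isolated iso v∈f q) (Star.at₃ s) (proj₂ (proj₂ (joins-other v∈f))) r q
      = case multiple? e₁ of λ
        { (yes m₁) → digon-income iso v∈f q s p₁ p₂ m₁
        ; (no ¬m₁) → case multiple? e₂ of λ
          { (yes m₂) → digon-income iso v∈f q (star at₂ at₁ at₃ (≢₁₂ ∘ sym) ≢₂₃ ≢₁₃) p₂ p₁ m₂
          ; (no ¬m₂) → inj₁ (ℕ.≤-reflexive (sym (trans (income-star s p₁ p₂ q)
              (cong₂ _+_ (single-income iso v∈f q at₁ p₁ ¬m₁) (single-income iso v∈f q at₂ p₂ ¬m₂))))) } }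
      where open Star s

    isolated-blank : ∀ {v f} → Isolated C v → v ∈ᵉ f → hue C f ≡ nothing
    isolated-blank {v} {f} iso v∈f = go (hue C f) refl
      where
      go : ∀ h → hue C f ≡ h → h ≡ nothing
      go nothing  _ = refl
      go (just k) p = contradiction p (iso k f v∈f)

    -- Twins determine each other through their coloured edges, so they match neighbours of `v` in
    -- pairs. The number of neighbours is three, hence one of them is unmatched and has the required
    -- income.
    isolated-income : ∀ {v} → Isolated C v → ∃ λ f → v ∈ᵉ f × 2 ≤ income (other v f)
    isolated-income {v} iso with star₀ v
    ... | f , _ , _ , s = first (isolated-edge iso (Star.at₁ s) (blank (Star.at₁ s)))
      where
      blank : ∀ {f} → v ∈ᵉ f → hue C f ≡ nothing
      blank = isolated-blank iso
      distinct : ∀ {f g} → v ∈ᵉ f → v ∈ᵉ g → other v f ≡ other v g → f ≡ g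
      distinct {f} {g} v∈f v∈g eq = same-blank (social-near-isolated iso v∈f (blank v∈f))
        (proj₂ (proj₂ (joins-other v∈f))) (subst (_∈ᵉ g) (sym eq) (proj₂ (proj₂ (joins-other v∈g)))) (blank v∈f) (blank v∈g)
      clash : ∀ {f g f₃ g₃} → Star v f g f₃ → Twins f g v → ¬ Twins f₃ g₃ v
      clash {f} {g} {f₃} {g₃} s T T₃
        with h , z₃∈h , p ← ¬misses⇒sees C {k = true} (λ m → social-near-isolated iso (Star.at₃ s) (blank (Star.at₃ s)) (true , m))
        with z∈h ← subst (_∈ᵉ h) (Twins.via-z T₃ z₃∈h p) (proj₂ (proj₂ (joins-other z₃∈h)))
        with back ← Twins.via-a T₃ z∈h p
        with Star.only s g₃ (Twins.v∈g T₃)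
      ... | inj₁ refl = Star.≢₂₃ s (distinct (Star.at₂ s) (Star.at₃ s) (trans (sym (Twins.via-z T z∈h p)) back))
      ... | inj₂ (inj₁ refl) = Star.≢₁₃ s (distinct (Star.at₁ s) (Star.at₃ s) (trans (sym (Twins.via-a T z∈h p)) back))
      ... | inj₂ (inj₂ g₃≡f₃) = Twins.f≢g T₃ (sym g₃≡f₃)
      first : 2 ≤ income (other v f) ⊎ ∃ (λ g → Twins f g v) → ∃ λ f → v ∈ᵉ f × 2 ≤ income (other v f)
      first (inj₁ rich) = f , Star.at₁ s , rich
      first (inj₂ (g , T)) with star₂ (Star.at₁ s) (Twins.v∈g T) (Twins.f≢g T)
      ... | f₃ , s₃ with isolated-edge iso (Star.at₃ s₃) (blank (Star.at₃ s₃))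
      ...   | inj₁ rich = f₃ , Star.at₃ s₃ , rich
      ...   | inj₂ (g₃ , T₃) = contradiction T₃ (clash s₃ T)

    -- Flow and local balance

    opaque
      -- The rule applies to every sender: across a gap the two path ends give each other two units,
      -- which cancel.
      flow : V → E → ℕ
      flow v f = maybe′ (const (relay 3 v f))
        (when (deficient? C (other v f)) (2 + when (isolated? C (other v f)) (income v))) (hue C f)

    gain : V → E → ℕ
    gain v f = shade (hue C f) 5 + flow (other v f) f

    opaque
      unfolding flow

      flow-coloured : ∀ {v f k} → hue C f ≡ just k → flow v f ≡ relay 3 v f
      flow-coloured {v} {f} p = cong (maybe′ (const (relay 3 v f)) _) p

    opaque
      unfolding flow

      flow-blank : ∀ {v f} → hue C f ≡ nothing →
                   flow v f ≡ when (deficient? C (other v f)) (2 + when (isolated? C (other v f)) (income v))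
      flow-blank {v} {f} q = cong (maybe′ (const (relay 3 v f)) _) q

    flow-sated : ∀ {v f} → hue C f ≡ nothing → ¬ Deficient C (other v f) → flow v f ≡ 0
    flow-sated q ¬d = trans (flow-blank q) (when-false (deficient? C _) ¬d)

    flow-deficient : ∀ {v f} → hue C f ≡ nothing → Deficient C (other v f) → ¬ Isolated C (other v f) → flow v f ≡ 2
    flow-deficient q d ¬iso = trans (flow-blank q) (trans (when-true (deficient? C _) d)
      (cong (2 +_) (when-false (isolated? C _) ¬iso)))

    flow-isolated : ∀ {v f} → hue C f ≡ nothing → Isolated C (other v f) → flow v f ≡ 2 + income v
    flow-isolated q iso = trans (flow-blank q) (trans (when-true (deficient? C _) (true , iso true))
      (cong (2 +_) (when-true (isolated? C _) iso)))

    other-other : ∀ {v f} → v ∈ᵉ f → other (other v f) f ≡ v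
    other-other v∈f = joins⇒other (joins-sym (joins-other v∈f))

    gain-coloured : ∀ v {f k} → hue C f ≡ just k → gain v f ≡ 5 + relay 3 (other v f) f
    gain-coloured v {f} p = cong₂ _+_ (cong (λ h → shade h 5) p) (flow-coloured p)

    gain-5 : ∀ v {f k} → hue C f ≡ just k → 5 ≤ gain v f
    gain-5 v p = subst (5 ≤_) (sym (gain-coloured v p)) (ℕ.m≤m+n 5 _)

    gain-deficient : ∀ {v f} → v ∈ᵉ f → Deficient C v → hue C f ≡ nothing → 2 ≤ gain v f
    gain-deficient {v} {f} v∈f d q = ℕ.≤-trans (ℕ.≤-trans (ℕ.m≤m+n 2 _)
      (ℕ.≤-reflexive (sym (trans (flow-blank q) (when-true (deficient? C _) (subst (Deficient C) (sym (other-other v∈f)) d))))))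
      (ℕ.m≤n+m _ _)

    gain-isolated : ∀ {v f} → v ∈ᵉ f → Isolated C v → hue C f ≡ nothing → 2 + income (other v f) ≤ gain v f
    gain-isolated {v} {f} v∈f iso q = ℕ.≤-trans
      (ℕ.≤-reflexive (sym (flow-isolated q (subst (Isolated C) (sym (other-other v∈f)) iso)))) (ℕ.m≤n+m _ _)

    -- A vertex that misses `d` colours has `2 - d` coloured edges, which contribute `5 * (2 - d)`
    -- to the gain. So the condition says that the two initial units plus inflow minus outflow cover
    -- `5 * d`; the 8 is `5 * 2 - 2`.
    Balanced : V → Set
    Balanced v = 8 + sumAt v (flow v) ≤ sumAt v (gain v)

    balance : ∀ {v e₁ e₂ e₃} (a₁ a₂ a₃ b₁ b₂ b₃ : ℕ) → Star v e₁ e₂ e₃ →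
              flow v e₁ ≤ a₁ → flow v e₂ ≤ a₂ → flow v e₃ ≤ a₃ →
              b₁ ≤ gain v e₁ → b₂ ≤ gain v e₂ → b₃ ≤ gain v e₃ →
              8 + (a₁ + (a₂ + a₃)) ≤ b₁ + (b₂ + b₃) → Balanced v
    balance {v} {e₁} {e₂} {e₃} a₁ a₂ a₃ b₁ b₂ b₃ s p₁ p₂ p₃ q₁ q₂ q₃ a≤b = begin
      8 + sumAt v (flow v)                          ≡⟨ cong (8 +_) (sumAt-star (flow v) s) ⟩
      8 + (flow v e₁ + (flow v e₂ + flow v e₃))     ≤⟨ ℕ.+-monoʳ-≤ 8 (ℕ.+-mono-≤ p₁ (ℕ.+-mono-≤ p₂ p₃)) ⟩
      8 + (a₁ + (a₂ + a₃))                          ≤⟨ a≤b ⟩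
      b₁ + (b₂ + b₃)                                ≤⟨ ℕ.+-mono-≤ q₁ (ℕ.+-mono-≤ q₂ q₃) ⟩
      gain v e₁ + (gain v e₂ + gain v e₃)           ≡⟨ sumAt-star (gain v) s ⟨
      sumAt v (gain v)                              ∎
      where open ℕ.≤-Reasoning

    star-blank : ∀ {v e₁ e₂ g} → Star v e₁ e₂ g → hue C e₁ ≢ nothing → hue C e₂ ≢ nothing →
                 ∀ {f} → v ∈ᵉ f → hue C f ≡ nothing → f ≡ g
    star-blank s c₁ c₂ v∈f q with Star.only s _ v∈f
    ... | inj₁ refl = contradiction q c₁
    ... | inj₂ (inj₁ refl) = contradiction q c₂
    ... | inj₂ (inj₂ f≡g) = f≡g

    not-blank : ∀ {e k} → hue C e ≡ just k → hue C e ≢ nothing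
    not-blank p q with () ← trans (sym p) q

    balanced-sated : ∀ {v} → ¬ Deficient C v → Balanced v
    balanced-sated {v} ¬d with sated-star ¬d
    ... | e₁ , e₂ , g , s , p₁ , p₂ , q = case exposed? v of λ
      { (no ¬ex) → balance 1 1 0 5 5 0 s
          (ℕ.≤-reflexive (trans (flow-coloured p₁) (relay-sheltered 2 ¬ex)))
          (ℕ.≤-reflexive (trans (flow-coloured p₂) (relay-sheltered 2 ¬ex)))
          (ℕ.≤-reflexive (flow-sated q λ d → ¬ex (g , Star.at₃ s , q , d)))
          (gain-5 v p₁) (gain-5 v p₂) z≤n ℕ.≤-refl
      ; (yes ex) → case lonely? v of λ
        -- What arrives along one coloured edge leaves along the other, hence the interchange of
        -- `i₁` and `i₂`; the own two units go to the path end across `g`.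
        { (no ¬l) → balance i₂ i₁ 2 (5 + i₁) (5 + i₂) 0 s
            (ℕ.≤-trans (ℕ.≤-reflexive (trans (flow-coloured p₁) (passed s p₂ q ex ¬l))) (relay-mono 2 _ e₂))
            (ℕ.≤-trans (ℕ.≤-reflexive (trans (flow-coloured p₂) (passed s′ p₁ q ex ¬l))) (relay-mono 2 _ e₁))
            (ℕ.≤-reflexive (flow-deficient q (g-deficient ex) λ iso → ¬l (g , Star.at₃ s , q , iso)))
            (ℕ.≤-reflexive (sym (gain-coloured v p₁))) (ℕ.≤-reflexive (sym (gain-coloured v p₂))) z≤n
            (ℕ.≤-reflexive (leaf-case i₁ i₂))
        ; (yes l) → balance 0 0 (2 + (i₁ + i₂)) (5 + i₁) (5 + i₂) 0 s
            (ℕ.≤-reflexive (trans (flow-coloured p₁) (relay-lonely 3 l)))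
            (ℕ.≤-reflexive (trans (flow-coloured p₂) (relay-lonely 3 l)))
            (ℕ.≤-reflexive (trans (flow-isolated q (g-isolated l)) (cong (2 +_) (income-star s p₁ p₂ q))))
            (ℕ.≤-reflexive (sym (gain-coloured v p₁))) (ℕ.≤-reflexive (sym (gain-coloured v p₂))) z≤n
            (ℕ.≤-reflexive (isolated-case i₁ i₂)) } }
      where
      open Star s using (≢₁₂; ≢₁₃; ≢₂₃; at₁; at₂; at₃)
      i₁ i₂ : ℕ
      i₁ = relay 3 (other v e₁) e₁
      i₂ = relay 3 (other v e₂) e₂
      s′ : Star v e₂ e₁ g
      s′ = star at₂ at₁ at₃ (≢₁₂ ∘ sym) ≢₂₃ ≢₁₃
      leaf-case : ∀ a b → 8 + (b + (a + 2)) ≡ 5 + a + (5 + b + 0)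
      leaf-case = solve-∀
      isolated-case : ∀ a b → 8 + (0 + (0 + (2 + (a + b)))) ≡ 5 + a + (5 + b + 0)
      isolated-case = solve-∀
      g-deficient : Exposed v → Deficient C (other v g)
      g-deficient (f , v∈f , r , d) with refl ← star-blank s (not-blank p₁) (not-blank p₂) v∈f r = d
      g-isolated : Lonely v → Isolated C (other v g)
      g-isolated (f , v∈f , r , iso) with refl ← star-blank s (not-blank p₁) (not-blank p₂) v∈f r = iso
      passed : ∀ {e₁ e₂ g k} → Star v e₁ e₂ g → hue C e₂ ≡ just k → hue C g ≡ nothing → Exposed v → ¬ Lonely v →
               relay 3 v e₁ ≡ relay 2 (other v e₂) e₂
      passed {e₁} {e₂} {g} s p₂ q ex ¬l = trans (relay-exposed 2 ex ¬l) (trans (sumAt-star summand s)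
        (trans (cong₂ _+_ (when-false (¬? (e₁ ≟ e₁)) λ ne → ne refl)
          (cong₂ _+_
            (trans (when-true (¬? (e₂ ≟ e₁)) (Star.≢₁₂ s ∘ sym)) (cong (λ h → shade h (relay 2 (other v e₂) e₂)) p₂))
            (trans (when-true (¬? (g ≟ e₁)) (Star.≢₁₃ s ∘ sym)) (cong (λ h → shade h (relay 2 (other v g) g)) q))))
          (ℕ.+-identityʳ _)))
        where
        summand : E → ℕ
        summand f = when (¬? (f ≟ e₁)) (shade (hue C f) (relay 2 (other v f) f))

    missing-blank : ∀ {v h f k} → v ∈ᵉ h → hue C h ≡ just k → Misses C v (not k) → v ∈ᵉ f → f ≢ h → hue C f ≡ nothing
    missing-blank {v} {h} {f} {k} v∈h p m v∈f f≢h = go (hue C f) refl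
      where
      go : ∀ c → hue C f ≡ c → c ≡ nothing
      go nothing  _ = refl
      go (just j) q with j Bool.≟ k
      ... | yes refl = contradiction (proper C v∈f v∈h q p) f≢h
      ... | no j≢k = contradiction (trans q (cong just (¬-not j≢k))) (m f v∈f)

    -- The ten units are its own two, two from each of three neighbours, and the income of two from
    -- the neighbour that `isolated-income` supplies.
    balanced-isolated : ∀ {v} → Isolated C v → Balanced v
    balanced-isolated {v} iso with isolated-income iso
    ... | f₁ , v∈f₁ , rich with star₁ v∈f₁
    ...   | f₂ , f₃ , s = balance 0 0 0 4 2 2 s (none at₁) (none at₂) (none at₃)
      (ℕ.≤-trans (ℕ.+-monoʳ-≤ 2 rich) (gain-isolated at₁ iso (blank at₁)))
      (gain-deficient at₂ (true , iso true) (blank at₂))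
      (gain-deficient at₃ (true , iso true) (blank at₃)) ℕ.≤-refl
      where
      open Star s
      blank : ∀ {f} → v ∈ᵉ f → hue C f ≡ nothing
      blank = isolated-blank iso
      none : ∀ {f} → v ∈ᵉ f → flow v f ≤ 0
      none v∈f = ℕ.≤-reflexive (flow-sated (blank v∈f) (social-near-isolated iso v∈f (blank v∈f)))

    -- Without a gap, a path end has 2 + 2 + 2 units and can spare one for its coloured edge. With a
    -- gap it has 2 + 2, gets the fifth unit along its coloured edge, and relays nothing because it
    -- has no second coloured edge.
    balanced-leaf : ∀ {u} → Deficient C u → Social C u → Balanced u
    balanced-leaf {u} d@(j , mj) (k , h , u∈h , p) = case exposed? u of λ
      { (no ¬ex) → unexposed ¬ex
      ; (yes (f , u∈f , q , d′)) → exposed (openEdge (joins-other u∈f) q d d′) (rotate C max (openEdge (joins-other u∈f) q d d′)) }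
      where
      mu : Misses C u (not k)
      mu = subst (Misses C u) (¬-not λ { refl → mj h u∈h p }) mj
      unexposed : ¬ Exposed u → Balanced u
      unexposed ¬ex with star₁ u∈h
      ... | f₁ , f₂ , s = balance 1 0 0 5 2 2 s
        (ℕ.≤-reflexive (trans (flow-coloured p) (relay-sheltered 2 ¬ex)))
        (none at₂ b₁) (none at₃ b₂) (gain-5 u p)
        (gain-deficient at₂ d b₁) (gain-deficient at₃ d b₂) ℕ.≤-refl
        where
        open Star s
        b₁ : hue C f₁ ≡ nothing
        b₁ = missing-blank u∈h p mu at₂ (≢₁₂ ∘ sym)
        b₂ : hue C f₂ ≡ nothing
        b₂ = missing-blank u∈h p mu at₃ (≢₁₃ ∘ sym)
        none : ∀ {f} → u ∈ᵉ f → hue C f ≡ nothing → flow u f ≤ 0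
        none u∈f q = ℕ.≤-reflexive (flow-sated q λ d′ → ¬ex (_ , u∈f , q , d′))
      exposed : ∀ {f} → OpenEdge C f u (other u f) → Rotation C f u (other u f) → Balanced u
      exposed {f} o R with star₂ {u} {f} {Rotation.h R} (proj₁ (proj₂ (OpenEdge.joins o)))
          (proj₂ (proj₂ (Rotation.h-joins R))) (apart C (OpenEdge.blank o) (Rotation.h-hue R))
      ... | g , s = balance 2 0 0 2 6 2 s
        (ℕ.≤-reflexive (flow-deficient o.blank o.def₂ (social⇒¬isolated C (_ , sees₂))))
        (ℕ.≤-reflexive (trans (flow-coloured R.h-hue) kept))
        (ℕ.≤-reflexive (flow-sated g-blank g-sated))
        (gain-deficient at₁ d o.blank)
        (subst (6 ≤_) (sym (gain-coloured u R.h-hue)) (ℕ.+-monoʳ-≤ 5 {1}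
          (subst (λ w → 1 ≤ relay 3 w R.h) (sym (joins⇒other (joins-sym R.h-joins))) (gap-receives o R))))
        (gain-deficient at₃ d g-blank) ℕ.≤-refl
        where
        module o = OpenEdge o
        module R = Rotation R
        open Polar R.polarity
        open Star s
        g-blank : hue C g ≡ nothing
        g-blank = missing-blank at₂ R.h-hue misses₁ at₃ (≢₂₃ ∘ sym)
        g-sated : ¬ Deficient C (other u g)
        g-sated dg = no-double-gap ≢₁₃ o
          (subst (OpenEdge C g u) (open-unique C max og o) og)
          where
          og : OpenEdge C g u (other u g)
          og = openEdge (joins-other at₃) g-blank d dg
        kept : relay 3 u R.h ≡ 0
        kept = case lonely? u of λ
          { (yes l) → relay-lonely 3 l
          ; (no ¬l) → trans (relay-exposed 2 (f , at₁ , o.blank , o.def₂) ¬l)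
              (trans (sumAt-star summand s) (cong₂ _+_ (silent o.blank)
                (cong₂ _+_ (when-false (¬? (R.h ≟ R.h)) λ ne → ne refl) (silent g-blank)))) }
          where
          summand : E → ℕ
          summand e = when (¬? (e ≟ R.h)) (shade (hue C e) (relay 2 (other u e) e))
          silent : ∀ {e} → hue C e ≡ nothing → summand e ≡ 0
          silent {e} q = trans (cong (λ c → when (¬? (e ≟ R.h)) (shade c (relay 2 (other u e) e))) q) (zero-when (¬? (e ≟ R.h)))
            where
            zero-when : ∀ {P : Set} (P? : Dec P) → when P? 0 ≡ 0
            zero-when (yes _) = refl
            zero-when (no _)  = refl

    balanced : ∀ v → Balanced v
    balanced v = case deficient? C v of λ
      { (no ¬d) → balanced-sated ¬d
      ; (yes d) → case social? C v of λ
        { (yes s) → balanced-leaf d s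
        ; (no ¬s) → balanced-isolated λ k e v∈e p → ¬s (k , e , v∈e , p) } }

    -- The flows cancel in the total, and each coloured edge is counted with 5 at both of its ends.
    8n≤10size : ∣V∣ G ℕ.* 8 ≤ 10 ℕ.* size C
    8n≤10size = ℕ.+-cancelʳ-≤ flows _ _ (begin
      ∣V∣ G ℕ.* 8 + flows                         ≡⟨ cong (_+ flows) (sum-const (∣V∣ G) 8) ⟨
      sum {∣V∣ G} (const 8) + flows               ≡⟨ ∑-distrib-+ {∣V∣ G} (const 8) _ ⟨
      sum (λ v → 8 + sumAt v (flow v))            ≤⟨ sum-mono balanced ⟩
      sum (λ v → sumAt v (gain v))                ≡⟨ sum-cong-≗ (λ v → sumAt-+ v (λ f → shade (hue C f) 5) (λ f → flow (other v f) f)) ⟩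
      sum (λ v → sumAt v (λ f → shade (hue C f) 5) + sumAt v λ f → flow (other v f) f) ≡⟨ ∑-distrib-+ (λ v → sumAt v (λ f → shade (hue C f) 5)) _ ⟩
      sum (λ v → sumAt v (λ f → shade (hue C f) 5)) + sum (λ v → sumAt v λ f → flow (other v f) f) ≡⟨ cong₂ _+_ fives (inflow≡outflow flow) ⟩
      10 ℕ.* size C + flows                       ∎)
      where
      open ℕ.≤-Reasoning
      flows : ℕ
      flows = sum λ v → sumAt v (flow v)
      shade-10 : ∀ h → shade h 5 + shade h 5 ≡ 10 ℕ.* shade h 1
      shade-10 (just _) = refl
      shade-10 nothing  = refl
      fives : sum (λ v → sumAt v (λ f → shade (hue C f) 5)) ≡ 10 ℕ.* size C
      fives = trans (handshake λ _ f → shade (hue C f) 5) (trans (sum-cong-≗ λ f → shade-10 (hue C f))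
        (sym (*-distribˡ-sum 10 λ f → shade (hue C f) 1)))

  -- From colourings to `ν`

  uncoloured : Colouring
  uncoloured = record { hue = const nothing ; proper = λ _ _ () }

  weight≤ : ∀ w C → weight w C ≤ sum w
  weight≤ w C = sum-mono λ e → bound (hue C e)
    where
    bound : ∀ h {x} → shade h x ≤ x
    bound (just _) = ℕ.≤-refl
    bound nothing  = z≤n

  -- The lexicographic maximum is taken in two stages, the second among colourings of the size found
  -- in the first. Both maxima exist under a double negation, which the decidable inequality
  -- removes.
  four-fifths : ∀ {s} → (∀ C → size C ≤ s) → 4 ℕ.* ∣V∣ G ≤ 5 ℕ.* s
  four-fifths {s} size≤s = decidable-stable (4 ℕ.* ∣V∣ G ℕ.≤? 5 ℕ.* s) λ fails →
    ¬¬-argmax size size≤s uncoloured λ (C , max) →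
    ¬¬-argmax {A = ∃ λ D → size D ≡ size C} (merit ∘ proj₁)
      (λ (D , _) → ℕ.+-mono-≤ (weight≤ multiplicity D) (sum-mono λ v → when-≤ (social? D v)))
      (C , refl) λ ((D , D≡C) , best) →
    fails (ℕ.*-cancelˡ-≤ 2 (begin
      2 ℕ.* (4 ℕ.* ∣V∣ G)   ≡⟨ eight (∣V∣ G) ⟩
      ∣V∣ G ℕ.* 8           ≤⟨ Discharging.8n≤10size D record
                                { max = maximum-≡ C D max D≡C
                                ; best = λ D′ D′≡D → best (D′ , trans D′≡D D≡C) } ⟩
      10 ℕ.* size D         ≤⟨ ℕ.*-monoʳ-≤ 10 (size≤s D) ⟩
      10 ℕ.* s              ≡⟨ ℕ.*-assoc 2 5 s ⟩
      2 ℕ.* (5 ℕ.* s)       ∎))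
    where
    open ℕ.≤-Reasoning
    eight : ∀ n → 2 ℕ.* (4 ℕ.* n) ≡ n ℕ.* 8
    eight = solve-∀

  size≤ν₂ : ∀ C → size C ≤ ν 2 G
  size≤ν₂ C = proj₂ (ν-isMaximum 2 G) (size C) (spanning G F , (c , c-proper) , ∣F∣≡)
    where
    F : Subset (∣E∣ G)
    F = tabulate λ e → is-just (hue C e)
    c : E → Fin 2
    -- The value `0F` on uncoloured edges is arbitrary, as properness is tested on `F` only.
    c e = maybe′ fromBool 0F (hue C e)
    ∣F∣≡ : ∣ F ∣ ≡ size C
    ∣F∣≡ = trans (∣∣≡sum F) (sum-cong-≗ λ e → trans
      (cong (λ b → if b then 1 else 0) (lookup∘tabulate (is-just ∘ hue C) e)) (one (hue C e)))
      where
      one : ∀ h → (if is-just h then 1 else 0) ≡ shade h 1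
      one (just _) = refl
      one nothing  = refl
    coloured : ∀ {e} → e ∈ F → ∃ λ k → hue C e ≡ just k
    coloured {e} e∈F = go (hue C e) (trans (sym (lookup∘tabulate (is-just ∘ hue C) e)) ([]=⇒lookup e∈F))
      where
      go : ∀ h → is-just h ≡ true → ∃ λ k → h ≡ just k
      go (just k) _ = k , refl
    c-proper : ProperOn G F c
    c-proper e f e∈F f∈F e≢f v v∈e v∈f ce≡cf with coloured e∈F | coloured f∈F
    ... | j , p | k , q = e≢f (proper C v∈e v∈f p (trans q (cong just (sym j≡k))))
      where
      j≡k : j ≡ k
      j≡k = fromBool-injective (trans (sym (cong (maybe′ fromBool 0F) p)) (trans ce≡cf (cong (maybe′ fromBool 0F) q)))

  -- Instead of singling out the smallest class, all three deletions are added up: every edge of `F`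
  -- survives exactly two of them.
  2ν₃≤3ν₂ : 2 ℕ.* ν 3 G ≤ 3 ℕ.* ν 2 G
  2ν₃≤3ν₂ with proj₁ (ν-isMaximum 3 G)
  ... | H , (c , c-proper) , ∣F∣≡ = begin
    2 ℕ.* ν 3 G                     ≡⟨ cong (2 ℕ.*_) ∣F∣≡ ⟨
    2 ℕ.* ∣ F ∣                     ≡⟨ cong (2 ℕ.*_) (∣∣≡sum F) ⟩
    2 ℕ.* sum (λ e → if lookup F e then 1 else 0) ≡⟨ *-distribˡ-sum 2 (λ e → if lookup F e then 1 else 0) ⟩
    sum (λ e → 2 ℕ.* (if lookup F e then 1 else 0)) ≡⟨ sum-cong-≗ (λ e → twice (lookup F e) (c e)) ⟩
    sum (λ e → shade (hue (D 0F) e) 1 + (shade (hue (D 1F) e) 1 + shade (hue (D 2F) e) 1))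
      ≡⟨ ∑-distrib-+ (λ e → shade (hue (D 0F) e) 1) _ ⟩
    size (D 0F) + sum (λ e → shade (hue (D 1F) e) 1 + shade (hue (D 2F) e) 1)
      ≡⟨ cong (λ s → size (D 0F) + s) (∑-distrib-+ (λ e → shade (hue (D 1F) e) 1) _) ⟩
    size (D 0F) + (size (D 1F) + size (D 2F))
      ≤⟨ ℕ.+-mono-≤ (size≤ν₂ (D 0F)) (ℕ.+-mono-≤ (size≤ν₂ (D 1F)) (size≤ν₂ (D 2F))) ⟩
    ν 2 G + (ν 2 G + ν 2 G)         ≡⟨ cong (λ x → ν 2 G + (ν 2 G + x)) (ℕ.+-identityʳ _) ⟨
    3 ℕ.* ν 2 G                     ∎
    where
    open ℕ.≤-Reasoning
    F : Subset (∣E∣ G)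
    F = edges H
    kept : Fin 3 → Bool → Fin 3 → Maybe Bool
    kept i b x = if b then discard i x else nothing
    twice : ∀ b x → 2 ℕ.* (if b then 1 else 0) ≡ shade (kept 0F b x) 1 + (shade (kept 1F b x) 1 + shade (kept 2F b x) 1)
    twice false _  = refl
    twice true  0F = refl
    twice true  1F = refl
    twice true  2F = refl
    D : Fin 3 → Colouring
    D i = record { hue = λ e → kept i (lookup F e) (c e) ; proper = D-proper }
      where
      kept-just : ∀ b x {k} → kept i b x ≡ just k → b ≡ true × discard i x ≡ just k
      kept-just true x p = refl , p
      D-proper : ∀ {v e f k} → v ∈ᵉ e → v ∈ᵉ f → kept i (lookup F e) (c e) ≡ just k → kept i (lookup F f) (c f) ≡ just k → e ≡ f
      D-proper {v} {e} {f} v∈e v∈f p q with e ≟ f | kept-just (lookup F e) (c e) p | kept-just (lookup F f) (c f) q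
      ... | yes e≡f | _ | _ = e≡f
      ... | no e≢f | e∈F , p′ | f∈F , q′ = contradiction (discard-injective i (c e) (c f) p′ q′)
        (c-proper e f (lookup⇒[]= e F e∈F) (lookup⇒[]= f F f∈F) e≢f v v∈e v∈f)

  -- One copy of the first bound and four of the second produce the ratio 1 : 2 of `∣V∣ G` and
  -- `ν 3 G`; the 17 is `5 + 4 * 3`.
  4n+8ν₃≤17ν₂ : 4 ℕ.* (∣V∣ G + 2 ℕ.* ν 3 G) ≤ 17 ℕ.* ν 2 G
  4n+8ν₃≤17ν₂ = begin
    4 ℕ.* (∣V∣ G + 2 ℕ.* ν 3 G)              ≡⟨ ℕ.*-distribˡ-+ 4 (∣V∣ G) _ ⟩
    4 ℕ.* ∣V∣ G + 4 ℕ.* (2 ℕ.* ν 3 G)        ≤⟨ ℕ.+-mono-≤ (four-fifths size≤ν₂) (ℕ.*-monoʳ-≤ 4 2ν₃≤3ν₂) ⟩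
    5 ℕ.* ν 2 G + 4 ℕ.* (3 ℕ.* ν 2 G)        ≡⟨ seventeen (ν 2 G) ⟩
    17 ℕ.* ν 2 G                             ∎
    where
    open ℕ.≤-Reasoning
    seventeen : ∀ x → 5 ℕ.* x + 4 ℕ.* (3 ℕ.* x) ≡ 17 ℕ.* x
    seventeen = solve-∀

-- The inequality in rational form

open import Data.Integer.Base as ℤ using (+_)
import Data.Integer.Properties as ℤ

-- Unnormalised fractions keep the denominators 17, 4 and 1, so that cross-multiplication gives
-- `16 * m ≤ 68 * x`, four times the hypothesis.
16/17*m/4≤x : ∀ m x → 4 ℕ.* m ≤ 17 ℕ.* x → (+ x) / 1 ≥ ((+ 16) / 17) * ((+ m) / 4)
16/17*m/4≤x m x 4m≤17x = ℚ.toℚᵘ-cancel-≤ (begin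
  toℚᵘ (((+ 16) / 17) * ((+ m) / 4))              ≃⟨ ℚ.toℚᵘ-homo-* ((+ 16) / 17) ((+ m) / 4) ⟩
  toℚᵘ ((+ 16) / 17) ℚᵘ.* toℚᵘ ((+ m) / 4)        ≃⟨ ℚᵘ.*-congˡ {toℚᵘ ((+ 16) / 17)} (ℚ.toℚᵘ-fromℚᵘ (mkℚᵘ (+ m) 3)) ⟩
  mkℚᵘ (+ 16) 16 ℚᵘ.* mkℚᵘ (+ m) 3                ≤⟨ *≤* (subst₂ ℤ._≤_ left right (ℤ.+≤+ (ℕ.*-monoʳ-≤ 4 4m≤17x))) ⟩
  mkℚᵘ (+ x) 0                                    ≃⟨ ℚ.toℚᵘ-fromℚᵘ (mkℚᵘ (+ x) 0) ⟨
  toℚᵘ ((+ x) / 1)                                ∎)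
  where
  open ℚᵘ.≤-Reasoning
  four-fours : ∀ m → 4 ℕ.* (4 ℕ.* m) ≡ 16 ℕ.* m ℕ.* 1
  four-fours = solve-∀
  sixty-eight : ∀ x → 4 ℕ.* (17 ℕ.* x) ≡ x ℕ.* 68
  sixty-eight = solve-∀
  left : + (4 ℕ.* (4 ℕ.* m)) ≡ + 16 ℤ.* + m ℤ.* + 1
  left = trans (cong +_ (four-fours m)) (trans (ℤ.pos-* (16 ℕ.* m) 1) (cong (ℤ._* + 1) (ℤ.pos-* 16 m)))
  right : + (4 ℕ.* (17 ℕ.* x)) ≡ + x ℤ.* + 68
  right = trans (cong +_ (sixty-eight x)) (ℤ.pos-* x 68)

theorem4 : (G : Graph) → Cubic G →
    (+ ν 2 G) / 1 ≥ ((+ 16) / 17) * ((+ (∣V∣ G ℕ.+ 2 ℕ.* ν 3 G)) / 4)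
theorem4 G cubic = 16/17*m/4≤x (∣V∣ G + 2 ℕ.* ν 3 G) (ν 2 G) (TwoColourings.4n+8ν₃≤17ν₂ G cubic)
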